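{- For any Dyck path $d$ of semilength $n$, $\{\mathrm{Des}(d,\sigma)\mid \sigma\in M_d\} = \{\mathrm{Des}(b,\delta_n)\mid b\in B_d\}$, where $\delta_n=n(n-1)\cdots 1$.
   Context: A Dyck path of semilength $n$ is a lattice path from $(0,0)$ to $(2n,0)$ with steps $U=(1,1)$ and $D=(1,-1)$ never going below the $x$-axis. A peak is an occurrence of $UD$, a valley an occurrence of $DU$; $\mathrm{pk}(e)$ is the number of peaks of $e$. The bounce path of $d$: start at $(0,0)$, take up-steps until reaching a point of $d$ where $d$'s next step is a down-step, then take down-steps to the $x$-axis, then up-steps until again meeting a down-step of $d$, and so on until $(2n,0)$; $\mathrm{bpk}(d)$ is the number of its peaks. For $\sigma=\sigma_1\cdots\sigma_n\in\mathfrak{S}_n$, $\mathrm{can}(d,\sigma)$ is the word of length $2n$ obtained by labeling the $i$-th up-step and the $i$-th down-step of $d$ with $\sigma_i$ and reading left to right; $\mathrm{Des}(d,\sigma)=\{j\in[2n-1]\mid \mathrm{can}(d,\sigma)_j>\mathrm{can}(d,\sigma)_{j+1}\}$ and $\mathrm{des}(d,\sigma)=|\mathrm{Des}(d,\sigma)|$; $m_d=\max_\sigma\mathrm{des}(d,\sigma)$, $M_d=\{\sigma\in\mathfrak{S}_n\mid\mathrm{des}(d,\sigma)=m_d\}$. A Dyck path $b$ is under $d$ if $b$ lies weakly below $d$. $B_d$ is the set of Dyck paths $b$ of semilength $n$ such that: $b$ is under $d$; $\mathrm{pk}(b)=\mathrm{bpk}(d)$ and every peak (top vertex) of $b$ lies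 on $d$; and every valley (bottom vertex) of $b$ is either a valley of $d$ or lies on the $x$-axis. -}

module Defs where

open import Data.Bool using (Bool; true; false; if_then_else_; _∧_; T)
open import Data.Nat using (ℕ; zero; suc; _+_; _*_; _∸_; _≤_; _<ᵇ_; _≡ᵇ_)
open import Data.List using (List; []; _∷_; length; map; downFrom; allFin)
open import Data.Maybe using (Maybe; just; nothing)
open import Data.Fin using (Fin; toℕ)
open import Data.Fin.Permutation using (Permutation′; _⟨$⟩ʳ_)
open import Data.Product using (Σ; _×_; _,_)
open import Data.Sum using (_⊎_)
open import Relation.Binary.PropositionalEquality using (_≡_)

-- A lattice word: true = U = (1,1), false = D = (1,-1).

dyckCheck : ℕ → List Bool → Bool
dyckCheck h []            = h ≡ᵇ 0
dyckCheck h (true ∷ w)    = dyckCheck (suc h) w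
dyckCheck zero (false ∷ w) = false
dyckCheck (suc h) (false ∷ w) = dyckCheck h w

record DyckPath (n : ℕ) : Set where
  constructor dyck
  field
    path  : List Bool
    len   : length path ≡ 2 * n
    valid : T (dyckCheck 0 path)
open DyckPath public

-- heightFrom h w k : height after the first k steps of w, starting at height h
-- (the vertex with x-coordinate k). Exact for Dyck paths (never negative).
heightFrom : ℕ → List Bool → ℕ → ℕ
heightFrom h w zero = h
heightFrom h [] (suc k) = h
heightFrom h (true ∷ w) (suc k) = heightFrom (suc h) w k
heightFrom h (false ∷ w) (suc k) = heightFrom (h ∸ 1) w k

height : List Bool → ℕ → ℕ
height = heightFrom 0

stepAt : List Bool → ℕ → Maybe Bool
stepAt [] k = nothing
stepAt (x ∷ w) zero = just x
stepAt (x ∷ w) (suc k) = stepAt w k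

-- A peak UD with steps k, k+1 (0-based); its top vertex is vertex k+1.
IsPeak : List Bool → ℕ → Set
IsPeak w k = stepAt w k ≡ just true × stepAt w (suc k) ≡ just false

-- A valley DU with steps k, k+1 (0-based); its bottom vertex is vertex k+1.
IsValley : List Bool → ℕ → Set
IsValley w k = stepAt w k ≡ just false × stepAt w (suc k) ≡ just true

pk : List Bool → ℕ
pk [] = 0
pk (true ∷ false ∷ w) = suc (pk (false ∷ w))
pk (x ∷ w) = pk w

isDown : Maybe Bool → Bool
isDown (just false) = true
isDown _ = false

-- Bounce path: from a point (x,0) go up j steps, where j ≥ 1 is least such that
-- the point (x+j, j) lies on d and d's next step there is a down-step.
findUp : ℕ → List Bool → ℕ → ℕ → Maybe ℕ
findUp zero d x j = nothing
findUp (suc f) d x j =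
  if (height d (x + j) ≡ᵇ j) ∧ isDown (stepAt d (x + j))
  then just j else findUp f d x (suc j)

bounceCount : ℕ → List Bool → ℕ → ℕ
bounceCount zero d x = 0
bounceCount (suc f) d x with x <ᵇ length d
... | false = 0
... | true with findUp (length d) d x 1
...   | nothing = 0
...   | just j = suc (bounceCount f d (x + 2 * j))

bpk : List Bool → ℕ
bpk d = bounceCount (length d) d 0

lookupℕ : List ℕ → ℕ → ℕ
lookupℕ [] i = 0
lookupℕ (x ∷ xs) zero = x
lookupℕ (x ∷ xs) (suc i) = lookupℕ xs i

canAux : List ℕ → ℕ → ℕ → List Bool → List ℕ
canAux s u v [] = []
canAux s u v (true ∷ w) = lookupℕ s u ∷ canAux s (suc u) v w
canAux s u v (false ∷ w) = lookupℕ s v ∷ canAux s u (suc v) w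

can : List Bool → List ℕ → List ℕ
can d s = canAux s 0 0 d

-- descent set (1-based positions j with w_j > w_{j+1}), in increasing order
desAux : ℕ → List ℕ → List ℕ
desAux j [] = []
desAux j (a ∷ []) = []
desAux j (a ∷ b ∷ w) =
  if b <ᵇ a then j ∷ desAux (suc j) (b ∷ w) else desAux (suc j) (b ∷ w)

DesWord : List ℕ → List ℕ
DesWord = desAux 1

word : ∀ {n} → Permutation′ n → List ℕ
word {n} σ = map (λ i → suc (toℕ (σ ⟨$⟩ʳ i))) (allFin n)

δ : ℕ → List ℕ
δ n = map suc (downFrom n)

Des : ∀ {n} → DyckPath n → Permutation′ n → List ℕ
Des (dyck d _ _) σ = DesWord (can d (word σ))

des : ∀ {n} → DyckPath n → Permutation′ n → ℕ
des d σ = length (Des d σ)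

InM : ∀ {n} → DyckPath n → Permutation′ n → Set
InM {n} d σ = (τ : Permutation′ n) → des d τ ≤ des d σ

InB : ∀ {n} → DyckPath n → DyckPath n → Set
InB (dyck d _ _) (dyck b _ _) =
  ((k : ℕ) → height b k ≤ height d k)
  × pk b ≡ bpk d
  × ((k : ℕ) → IsPeak b k → height b (suc k) ≡ height d (suc k))
  × ((k : ℕ) → IsValley b k →
       (IsValley d k × height d (suc k) ≡ height b (suc k)) ⊎ height b (suc k) ≡ 0)

DesDelta : ∀ {n} → DyckPath n → List ℕ
DesDelta {n} (dyck b _ _) = DesWord (can b (δ n))

{-# OPTIONS --safe #-}
module Submission where

-- Write up x and dn x for the numbers of up- and down-steps of d before vertex x, and call x a mark
-- of σ if the two labels read around x do not form a descent. Between the up-step and the down-step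
-- with a common label i the word cannot decrease throughout, so every i has a mark x with
-- dn x ≤ i < up x. The peaks of the bounce path are the greedy, hence smallest, set of vertices with
-- this covering property, so at least bpk d marks are always needed.
--
-- If σ has exactly bpk d marks, sorting the steps of d between consecutive marks (down-steps first)
-- gives a path b with these peaks: covering keeps b above the axis, and minimality makes every mark
-- a peak. Where the valley of b is off the axis, the inequalities between labels in three consecutive
-- runs show that d was sorted there already, so the valley belongs to d.
--
-- Conversely, given b, the labels are inserted into a linear order in the order of the up-steps of d:
-- at the bottom while b and d go up together, at the top when d goes on rising at a peak of b, and
-- immediately below the previously read label otherwise. Applied to the bounce path this also shows
-- that bpk d marks suffice.

open import Defs
open import Data.Bool using (Bool; true; false; if_then_else_; _∧_; not; T)
open import Data.Bool.Properties using (T-≡; ∧-zeroʳ)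
open import Data.Empty using (⊥; ⊥-elim)
open import Data.Fin using (Fin; zero; suc; toℕ; fromℕ<; punchOut)
import Data.Fin.Properties as Fin
open import Data.Fin.Permutation using (Permutation′; _⟨$⟩ʳ_; permutation)
open import Data.List using (List; []; _∷_; length; applyUpTo; tabulate)
open import Data.List.Properties using (map-tabulate; length-applyUpTo)
open import Data.Maybe using (just)
open import Data.Nat using (ℕ; zero; suc; _+_; _*_; _∸_; _≤_; _<_; _<ᵇ_; _≤ᵇ_; _≡ᵇ_; z≤n; s≤s)
open import Data.Nat.Properties
open import Data.Product using (∃; _×_; _,_; proj₁; proj₂)
open import Data.Sum using (_⊎_; inj₁; inj₂)
open import Function using (_∘_; id; case_of_; Equivalence)
open import Relation.Binary.PropositionalEquality
open import Relation.Nullary using (¬_; yes; no)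

private variable
  P Q : ℕ → Bool
  a b c i j k l m n p q x y z : ℕ

-- Booleans and counting functions

true≢false : ∀ {c} → c ≡ true → c ≡ false → ⊥
true≢false refl ()

<⇒<ᵇ≡true : m < n → (m <ᵇ n) ≡ true
<⇒<ᵇ≡true = Equivalence.to T-≡ ∘ <⇒<ᵇ

<ᵇ≡true⇒< : (m <ᵇ n) ≡ true → m < n
<ᵇ≡true⇒< {m} {n} = <ᵇ⇒< m n ∘ Equivalence.from T-≡

≥⇒<ᵇ≡false : n ≤ m → (m <ᵇ n) ≡ false
≥⇒<ᵇ≡false {n} {m} n≤m with m <ᵇ n in eq
... | false = refl
... | true  = ⊥-elim (<⇒≱ (<ᵇ≡true⇒< eq) n≤m)

<ᵇ≡false⇒≥ : (m <ᵇ n) ≡ false → n ≤ m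
<ᵇ≡false⇒≥ eq = ≮⇒≥ (λ m<n → true≢false (<⇒<ᵇ≡true m<n) eq)

≡ᵇ≡true⇒≡ : (m ≡ᵇ n) ≡ true → m ≡ n
≡ᵇ≡true⇒≡ {m} {n} = ≡ᵇ⇒≡ m n ∘ Equivalence.from T-≡

≡⇒≡ᵇ≡true : m ≡ n → (m ≡ᵇ n) ≡ true
≡⇒≡ᵇ≡true {m} {n} = Equivalence.to T-≡ ∘ ≡⇒≡ᵇ m n

cnt : (ℕ → Bool) → ℕ → ℕ
cnt P zero    = 0
cnt P (suc k) = if P k then suc (cnt P k) else cnt P k

cnt-true : P k ≡ true → cnt P (suc k) ≡ suc (cnt P k)
cnt-true e rewrite e = refl

cnt-false : P k ≡ false → cnt P (suc k) ≡ cnt P k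
cnt-false e rewrite e = refl

cnt-≤-suc : ∀ P k → cnt P k ≤ cnt P (suc k)
cnt-≤-suc P k with P k
... | true  = n≤1+n _
... | false = ≤-refl

cnt-mono : ∀ P → a ≤ b → cnt P a ≤ cnt P b
cnt-mono {b = zero}  P z≤n = z≤n
cnt-mono {b = suc b} P a≤b with m≤n⇒m<n∨m≡n a≤b
... | inj₁ (s≤s a≤b′) = ≤-trans (cnt-mono P a≤b′) (cnt-≤-suc P b)
... | inj₂ refl       = ≤-refl

cnt-mono-true : P a ≡ true → a < b → cnt P a < cnt P b
cnt-mono-true {P} e a<b = ≤-trans (≤-reflexive (sym (cnt-true {P} e))) (cnt-mono P a<b)

cnt-reflects-< : ∀ P → cnt P a < cnt P b → a < b
cnt-reflects-< P h = ≰⇒> (λ b≤a → <⇒≱ h (cnt-mono P b≤a))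

-- Turns an index into a step: with `P` the up-steps or the down-steps of a path, `p` is the step of
-- that kind that carries index `i`.
cnt-find : ∀ P z → i < cnt P z → ∃ λ p → p < z × P p ≡ true × cnt P p ≡ i
cnt-find {i} P (suc z) h with P z in eq
... | false = let p , p<z , r = cnt-find P z h in p , m<n⇒m<1+n p<z , r
... | true with m≤n⇒m<n∨m≡n (≤-pred h)
...   | inj₁ h′ = let p , p<z , r = cnt-find P z h′ in p , m<n⇒m<1+n p<z , r
...   | inj₂ e  = z , ≤-refl , eq , sym e

cnt-const : ∀ P → x ≤ y → (∀ {t} → x ≤ t → t < y → P t ≡ false) → cnt P y ≡ cnt P x
cnt-const {y = zero}  P z≤n h = refl
cnt-const {y = suc y} P x≤y h with m≤n⇒m<n∨m≡n x≤y
... | inj₂ refl       = refl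
... | inj₁ (s≤s x≤y′) = trans (cnt-false {P} (h x≤y′ ≤-refl))
                              (cnt-const P x≤y′ (λ p q → h p (m<n⇒m<1+n q)))

cnt-ext : ∀ k → (∀ {t} → t < k → P t ≡ Q t) → cnt P k ≡ cnt Q k
cnt-ext         zero    h = refl
cnt-ext {P} {Q} (suc k) h rewrite h {k} ≤-refl | cnt-ext {P} {Q} k (h ∘ m<n⇒m<1+n) = refl

cnt-strict : ∀ N → (∀ {t} → P t ≡ true → Q t ≡ true) →
             x < N → P x ≡ false → Q x ≡ true → cnt P N < cnt Q N
cnt-strict {P} {Q} {x} (suc N) sub x<N px qx = go (m≤n⇒m<n∨m≡n (≤-pred x<N))
  where
  weak : ∀ k → cnt P k ≤ cnt Q k
  weak zero = z≤n
  weak (suc k) with P k in e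
  ... | false = ≤-trans (weak k) (cnt-≤-suc Q k)
  ... | true rewrite sub e = s≤s (weak k)
  go : x < N ⊎ x ≡ N → cnt P (suc N) < cnt Q (suc N)
  go (inj₂ refl) rewrite px | qx = s≤s (weak N)
  go (inj₁ x<N′) with cnt-strict {P} {Q} N sub x<N′ px qx | P N in e
  ... | ih | false = ≤-trans ih (cnt-≤-suc Q N)
  ... | ih | true rewrite sub e = s≤s ih

cnt-not : ∀ P k → cnt P k + cnt (not ∘ P) k ≡ k
cnt-not P zero = refl
cnt-not P (suc k) with P k
... | true  = cong suc (cnt-not P k)
... | false = trans (+-suc _ _) (cong suc (cnt-not P k))

cnt-front : ∀ P k → cnt P (suc k) ≡ (if P 0 then suc (cnt (P ∘ suc) k) else cnt (P ∘ suc) k)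
cnt-front P zero = refl
cnt-front P (suc k) rewrite cnt-front P k with P 0 | P (suc k)
... | true  | true  = refl
... | true  | false = refl
... | false | true  = refl
... | false | false = refl

-- Dyck words as Boolean functions

up dn : (ℕ → Bool) → ℕ → ℕ
up s = cnt s
dn s = cnt (not ∘ s)

-- Only the values of `s` below `2 * n` matter, so paths can be cut and sorted without handling
-- lists.
record IsDyck (n : ℕ) (s : ℕ → Bool) : Set where
  field
    dn≤up  : ∀ {k} → k ≤ 2 * n → dn s k ≤ up s k
    up-end : up s (2 * n) ≡ n

not-true : ∀ {c} → c ≡ false → not c ≡ true
not-true refl = refl

not-false : ∀ {c} → c ≡ true → not c ≡ false
not-false refl = refl

not-true⁻¹ : ∀ {c} → not c ≡ true → c ≡ false
not-true⁻¹ {false} _ = refl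

not-false⁻¹ : ∀ {c} → not c ≡ false → c ≡ true
not-false⁻¹ {true} _ = refl

2*-+ : ∀ n → 2 * n ≡ n + n
2*-+ n = cong (n +_) (+-identityʳ n)

module Dyck {n : ℕ} {s : ℕ → Bool} (D : IsDyck n s) where
  open IsDyck D public

  N : ℕ
  N = 2 * n

  up+dn : ∀ k → up s k + dn s k ≡ k
  up+dn = cnt-not s

  dn-end : dn s N ≡ n
  dn-end = +-cancelˡ-≡ n _ _ (trans (cong (_+ dn s N) (sym up-end)) (trans (up+dn N) (2*-+ n)))

  up≤n : k ≤ N → up s k ≤ n
  up≤n h = ≤-trans (cnt-mono s h) (≤-reflexive up-end)

  dn≤n : k ≤ N → dn s k ≤ n
  dn≤n h = ≤-trans (cnt-mono (not ∘ s) h) (≤-reflexive dn-end)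

  up-U : s k ≡ true → up s (suc k) ≡ suc (up s k)
  up-U = cnt-true {s}

  up-D : s k ≡ false → up s (suc k) ≡ up s k
  up-D = cnt-false {s}

  dn-U : s k ≡ true → dn s (suc k) ≡ dn s k
  dn-U e = cnt-false {not ∘ s} (not-false e)

  dn-D : s k ≡ false → dn s (suc k) ≡ suc (dn s k)
  dn-D e = cnt-true {not ∘ s} (not-true e)

  dn<up-at-D : k < N → s k ≡ false → dn s k < up s k
  dn<up-at-D {k} k<N e = subst₂ _≤_ (dn-D e) (up-D e) (dn≤up k<N)

  up<n-at-U : k < N → s k ≡ true → up s k < n
  up<n-at-U {k} k<N e = subst (_≤ n) (up-U e) (up≤n k<N)

  dn<n-at-D : k < N → s k ≡ false → dn s k < n
  dn<n-at-D {k} k<N e = subst (_≤ n) (dn-D e) (dn≤n k<N)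

-- Lattice words as functions

at : List Bool → ℕ → Bool
at []      k       = false
at (x ∷ w) zero    = x
at (x ∷ w) (suc k) = at w k

stepAt-at : ∀ w → k < length w → stepAt w k ≡ just (at w k)
stepAt-at {zero}  (x ∷ w) h       = refl
stepAt-at {suc k} (x ∷ w) (s≤s h) = stepAt-at w h

stepAt-just : ∀ w {c} → stepAt w k ≡ just c → k < length w × at w k ≡ c
stepAt-just {zero}  (x ∷ w) refl = s≤s z≤n , refl
stepAt-just {suc k} (x ∷ w) e    = let h , e′ = stepAt-just w e in s≤s h , e′

at-applyUpTo : ∀ f N → k < N → at (applyUpTo f N) k ≡ f k
at-applyUpTo {zero}  f (suc N) h       = refl
at-applyUpTo {suc k} f (suc N) (s≤s h) = at-applyUpTo (f ∘ suc) N h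

-- Stated additively because `heightFrom` truncates at zero; validity of the word ensures that the
-- truncation never acts.
heightFrom-up-dn : ∀ h w k → T (dyckCheck h w) → k ≤ length w →
                   heightFrom h w k + dn (at w) k ≡ h + up (at w) k
heightFrom-up-dn h w zero t k≤ = refl
heightFrom-up-dn h (true ∷ w) (suc k) t (s≤s k≤)
  rewrite cnt-front (at (true ∷ w)) k | cnt-front (not ∘ at (true ∷ w)) k =
  trans (heightFrom-up-dn (suc h) w k t k≤) (sym (+-suc h _))
heightFrom-up-dn (suc h) (false ∷ w) (suc k) t (s≤s k≤)
  rewrite cnt-front (at (false ∷ w)) k | cnt-front (not ∘ at (false ∷ w)) k =
  trans (+-suc _ _) (cong suc (heightFrom-up-dn h w k t k≤))

heightFrom-end : ∀ h w → T (dyckCheck h w) → heightFrom h w (length w) ≡ 0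
heightFrom-end h       []          t = ≡ᵇ⇒≡ h 0 t
heightFrom-end h       (true ∷ w)  t = heightFrom-end (suc h) w t
heightFrom-end (suc h) (false ∷ w) t = heightFrom-end h w t

heightFrom-beyond : ∀ h w k → length w ≤ k → heightFrom h w k ≡ heightFrom h w (length w)
heightFrom-beyond h []          zero    _       = refl
heightFrom-beyond h []          (suc k) _       = refl
heightFrom-beyond h (true ∷ w)  (suc k) (s≤s l) = heightFrom-beyond (suc h) w k l
heightFrom-beyond h (false ∷ w) (suc k) (s≤s l) = heightFrom-beyond (h ∸ 1) w k l

dyckCheck-intro : ∀ h w → (∀ {k} → k ≤ length w → dn (at w) k ≤ h + up (at w) k) →
                  h + up (at w) (length w) ≡ dn (at w) (length w) → T (dyckCheck h w)
dyckCheck-intro h [] le e = ≡⇒≡ᵇ h 0 (trans (sym (+-identityʳ h)) e)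
dyckCheck-intro h (true ∷ w) le e =
  dyckCheck-intro (suc h) w (λ {k} k≤ → subst₂ _≤_ (fd k) (trans (cong (h +_) (fu k)) (+-suc h _)) (le (s≤s k≤)))
    (trans (sym (trans (cong (h +_) (fu (length w))) (+-suc h _))) (trans e (fd (length w))))
  where
  fu = cnt-front (at (true ∷ w))
  fd = cnt-front (not ∘ at (true ∷ w))
dyckCheck-intro zero (false ∷ w) le e with le {1} (s≤s z≤n)
... | ()
dyckCheck-intro (suc h) (false ∷ w) le e =
  dyckCheck-intro h w (λ {k} k≤ → ≤-pred (subst₂ _≤_ (fd k) (cong (suc h +_) (fu k)) (le (s≤s k≤))))
    (suc-injective (trans (cong (suc h +_) (sym (fu (length w)))) (trans e (fd (length w)))))
  where
  fu = cnt-front (at (false ∷ w))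
  fd = cnt-front (not ∘ at (false ∷ w))

peak : (ℕ → Bool) → ℕ → Bool
peak s k = s k ∧ not (s (suc k))

-- The count stops one letter early: `at` is `false` beyond the end, so a final up-step would pass
-- for a peak.
pk-cnt : ∀ w → pk w ≡ cnt (peak (at w)) (length w ∸ 1)
pk-cnt [] = refl
pk-cnt (true ∷ []) = refl
pk-cnt (false ∷ []) = refl
pk-cnt (true ∷ true ∷ w) = trans (pk-cnt (true ∷ w)) (sym (cnt-front (peak (at (true ∷ true ∷ w))) (length w)))
pk-cnt (true ∷ false ∷ w) = trans (cong suc (pk-cnt (false ∷ w))) (sym (cnt-front (peak (at (true ∷ false ∷ w))) (length w)))
pk-cnt (false ∷ y ∷ w) = trans (pk-cnt (y ∷ w)) (sym (cnt-front (peak (at (false ∷ y ∷ w))) (length w)))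

IsDyck-ext : ∀ {s t n} → (∀ {k} → k < 2 * n → s k ≡ t k) → IsDyck n s → IsDyck n t
IsDyck-ext {s} {t} {n} h D = record
  { dn≤up  = λ {k} k≤ → subst₂ _≤_ (cnt-ext {not ∘ s} k (λ l → cong not (h (<-≤-trans l k≤))))
                                   (cnt-ext {s} k (λ l → h (<-≤-trans l k≤))) (IsDyck.dn≤up D k≤)
  ; up-end = trans (sym (cnt-ext {s} (2 * n) h)) (IsDyck.up-end D) }

module _ {n : ℕ} (d : DyckPath n) where
  private w = path d

  height-up-dn : k ≤ 2 * n → height w k + dn (at w) k ≡ up (at w) k
  height-up-dn {k} k≤ = heightFrom-up-dn 0 w k (valid d) (subst (k ≤_) (sym (len d)) k≤)

  at-dyck : IsDyck n (at w)
  at-dyck = record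
    { dn≤up  = λ {k} k≤ → subst (dn (at w) k ≤_) (height-up-dn k≤) (m≤n+m _ _)
    ; up-end = *-cancelˡ-≡ _ _ 2 (trans (2*-+ (up (at w) (2 * n)))
                 (trans (cong (up (at w) (2 * n) +_) (sym eq)) (cnt-not (at w) (2 * n)))) }
    where
    eq : dn (at w) (2 * n) ≡ up (at w) (2 * n)
    eq = trans (cong (_+ dn (at w) (2 * n))
                 (sym (trans (cong (heightFrom 0 w) (sym (len d))) (heightFrom-end 0 w (valid d)))))
               (height-up-dn ≤-refl)

toPath : ∀ {n} (s : ℕ → Bool) → IsDyck n s → DyckPath n
toPath {n} s D = dyck w lw (dyckCheck-intro 0 w (λ k≤ → W.dn≤up (subst (_ ≤_) lw k≤))
    (subst (λ l → up (at w) l ≡ dn (at w) l) (sym lw) (trans W.up-end (sym W.dn-end))))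
  where
  w = applyUpTo s (2 * n)
  lw = length-applyUpTo s (2 * n)
  module W = Dyck (IsDyck-ext (λ k< → sym (at-applyUpTo s (2 * n) k<)) D)

<∸1⇒suc< : k < m ∸ 1 → suc k < m
<∸1⇒suc< {m = suc m} h = s≤s h

-- Letters and descents of the canonical word

-- The 0-based index into the permutation of the letter at position `k`: that many steps of the same
-- kind come before.
ix : (ℕ → Bool) → ℕ → ℕ
ix s k = if s k then up s k else dn s k

desBit : (ℕ → ℕ) → ℕ → Bool
desBit l k = l (suc k) <ᵇ l k

desAux-ext : ∀ j xs ys → length xs ≡ length ys →
  (∀ {k} → suc k < length xs → desBit (lookupℕ xs) k ≡ desBit (lookupℕ ys) k) →
  desAux j xs ≡ desAux j ys
desAux-ext j [] [] l h = refl
desAux-ext j (a ∷ []) (a′ ∷ []) l h = refl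
desAux-ext j (a ∷ b ∷ xs) (a′ ∷ b′ ∷ ys) l h =
  cong₂ (λ c r → if c then j ∷ r else r) (h {0} (s≤s (s≤s z≤n)))
    (desAux-ext (suc j) (b ∷ xs) (b′ ∷ ys) (suc-injective l) (h ∘ s≤s))

length-desAux : ∀ j xs → length (desAux j xs) ≡ cnt (desBit (lookupℕ xs)) (length xs ∸ 1)
length-desAux j [] = refl
length-desAux j (a ∷ []) = refl
length-desAux j (a ∷ b ∷ xs) = trans (push (b <ᵇ a))
    (trans (cong (λ r → if b <ᵇ a then suc r else r) (length-desAux (suc j) (b ∷ xs)))
           (sym (cnt-front (desBit (lookupℕ (a ∷ b ∷ xs))) (length xs))))
  where
  push : ∀ c {ys} → length (if c then j ∷ ys else ys) ≡ (if c then suc (length ys) else length ys)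
  push true  = refl
  push false = refl

length-canAux : ∀ t a b w → length (canAux t a b w) ≡ length w
length-canAux t a b []          = refl
length-canAux t a b (true ∷ w)  = cong suc (length-canAux t (suc a) b w)
length-canAux t a b (false ∷ w) = cong suc (length-canAux t a (suc b) w)

lookup-canAux : ∀ t a b w k → k < length w → lookupℕ (canAux t a b w) k ≡
  lookupℕ t (if at w k then a + up (at w) k else b + dn (at w) k)
lookup-canAux t a b (true ∷ w)  zero h = cong (lookupℕ t) (sym (+-identityʳ a))
lookup-canAux t a b (false ∷ w) zero h = cong (lookupℕ t) (sym (+-identityʳ b))
lookup-canAux t a b (true ∷ w) (suc k) (s≤s h)
  rewrite cnt-front (at (true ∷ w)) k | cnt-front (not ∘ at (true ∷ w)) k
        | +-suc a (up (at w) k) = lookup-canAux t (suc a) b w k h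
lookup-canAux t a b (false ∷ w) (suc k) (s≤s h)
  rewrite cnt-front (at (false ∷ w)) k | cnt-front (not ∘ at (false ∷ w)) k
        | +-suc b (dn (at w) k) = lookup-canAux t a (suc b) w k h

lookup-can : ∀ t w {k} → k < length w → lookupℕ (can w t) k ≡ lookupℕ t (ix (at w) k)
lookup-can t w {k} = lookup-canAux t 0 0 w k

desBit-can : ∀ t w {k} → suc k < length w →
  desBit (lookupℕ (can w t)) k ≡ desBit (lookupℕ t ∘ ix (at w)) k
desBit-can t w {k} h = cong₂ _<ᵇ_ (lookup-can t w h) (lookup-can t w (<-trans (n<1+n k) h))

-- Non-descents rather than strict ascents: at a peak of height one the two copies of a label are
-- adjacent, and this vertex has to count.
ascents : (ℕ → ℕ) → (ℕ → Bool) → ℕ → Bool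
ascents f s k = not (desBit (f ∘ ix s) k)

module _ {n : ℕ} (t : List ℕ) (d : DyckPath n) where
  private
    w = path d
    lc : length (can w t) ≡ 2 * n
    lc = trans (length-canAux t 0 0 w) (len d)
    <w : ∀ {k} → suc k < 2 * n → suc k < length w
    <w = subst (_ <_) (sym (len d))

  length-DesWord : length (DesWord (can w t)) + cnt (ascents (lookupℕ t) (at w)) (2 * n ∸ 1) ≡ 2 * n ∸ 1
  length-DesWord = trans (cong₂ _+_
      (trans (length-desAux 1 (can w t)) (cong (λ l → cnt (desBit (lookupℕ (can w t))) (l ∸ 1)) lc))
      (sym (cnt-ext (2 * n ∸ 1) (λ {k} k< → cong not (desBit-can t w (<w (<∸1⇒suc< k<)))))))
    (cnt-not (desBit (lookupℕ (can w t))) (2 * n ∸ 1))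

  DesWord-ext : ∀ t′ (d′ : DyckPath n) →
    (∀ {k} → suc k < 2 * n → ascents (lookupℕ t) (at w) k ≡ ascents (lookupℕ t′) (at (path d′)) k) →
    DesWord (can w t) ≡ DesWord (can (path d′) t′)
  DesWord-ext t′ d′ h = desAux-ext 1 (can w t) (can (path d′) t′)
    (trans lc (sym (trans (length-canAux t′ 0 0 (path d′)) (len d′))))
    (λ {k} k< → let k<N = subst (suc k <_) lc k< in
      trans (desBit-can t w (<w k<N))
        (trans (not-inj (h k<N)) (sym (desBit-can t′ (path d′) (subst (_ <_) (sym (len d′)) k<N)))))
    where
    not-inj : ∀ {a b} → not a ≡ not b → a ≡ b
    not-inj {true}  {true}  _ = refl
    not-inj {false} {false} _ = refl

lookup-δ : ∀ n → i < n → lookupℕ (δ n) i ≡ n ∸ i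
lookup-δ {zero}  (suc n) h       = refl
lookup-δ {suc i} (suc n) (s≤s h) = lookup-δ n h

module _ {n : ℕ} {s : ℕ → Bool} (D : IsDyck n s) where
  open Dyck D

  ix-U : s k ≡ true → ix s k ≡ up s k
  ix-U e rewrite e = refl

  ix-D : s k ≡ false → ix s k ≡ dn s k
  ix-D e rewrite e = refl

  ix<n : k < N → ix s k < n
  ix<n {k} k< with s k in e
  ... | true  = up<n-at-U k< e
  ... | false = dn<n-at-D k< e

  -- Under the decreasing permutation the two labels of a peak are the only adjacent labels read
  -- in weakly decreasing index order.
  ascents-δ : suc k < N → ascents (lookupℕ (δ n)) s k ≡ peak s k
  ascents-δ {k} h = go (s k) (s (suc k)) refl refl
    where
    k< : k < N
    k< = <-trans (n<1+n k) h
    lt : ix s k < ix s (suc k) → ascents (lookupℕ (δ n)) s k ≡ false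
    lt l = not-false (<⇒<ᵇ≡true (subst₂ _<_ (sym (lookup-δ n (ix<n h))) (sym (lookup-δ n (ix<n k<)))
             (∸-monoʳ-< l (<⇒≤ (ix<n h)))))
    ge : ix s (suc k) ≤ ix s k → ascents (lookupℕ (δ n)) s k ≡ true
    ge l = not-true (≥⇒<ᵇ≡false (subst₂ _≤_ (sym (lookup-δ n (ix<n k<))) (sym (lookup-δ n (ix<n h)))
             (∸-monoʳ-≤ n l)))
    go : ∀ p q → s k ≡ p → s (suc k) ≡ q → ascents (lookupℕ (δ n)) s k ≡ peak s k
    go true true e e′ = trans (lt (subst₂ _<_ (sym (ix-U e)) (sym (trans (ix-U e′) (up-U e))) ≤-refl))
      (sym (cong₂ _∧_ e (cong not e′)))
    go false false e e′ = trans (lt (subst₂ _<_ (sym (ix-D e)) (sym (trans (ix-D e′) (dn-D e))) ≤-refl))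
      (sym (cong₂ _∧_ e (cong not e′)))
    go false true e e′ = trans (lt (subst₂ _<_ (sym (ix-D e)) (sym (trans (ix-U e′) (up-D e))) (dn<up-at-D k< e)))
      (sym (cong₂ _∧_ e (cong not e′)))
    go true false e e′ = trans (ge (subst₂ _≤_ (sym (trans (ix-D e′) (dn-U e))) (sym (ix-U e)) (dn≤up (<⇒≤ k<))))
      (sym (cong₂ _∧_ e (cong not e′)))

-- Permutations from injective functions

lookup-tabulate : ∀ {n} (g : Fin n → ℕ) (i<n : i < n) → lookupℕ (tabulate g) i ≡ g (fromℕ< i<n)
lookup-tabulate {zero}  {suc n} g h = refl
lookup-tabulate {suc i} {suc n} g (s≤s h) = lookup-tabulate (g ∘ suc) h

lookup-word : ∀ {n} (σ : Permutation′ n) (i<n : i < n) →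
              lookupℕ (word σ) i ≡ suc (toℕ (σ ⟨$⟩ʳ fromℕ< i<n))
lookup-word {i} σ i<n = trans (cong (λ l → lookupℕ l i) (map-tabulate id (λ j → suc (toℕ (σ ⟨$⟩ʳ j)))))
                              (lookup-tabulate _ i<n)

-- Surjectivity is the pigeonhole principle: if `y` were missed, `punchOut` at `y` would inject
-- `Fin (suc n)` into `Fin n`. The preimages found by search form the inverse.
injective⇒permutation : (g : Fin n → Fin n) → (∀ {i j} → g i ≡ g j → i ≡ j) →
                        ∃ λ (σ : Permutation′ n) → ∀ i → σ ⟨$⟩ʳ i ≡ g i
injective⇒permutation {n} g inj = permutation g (proj₁ ∘ surj) (proj₂ ∘ surj) (λ i → inj (proj₂ (surj (g i)))) , λ _ → refl
  where
  surj : ∀ y → ∃ λ x → g x ≡ y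
  surj y with Fin.any? (λ x → g x Fin.≟ y)
  ... | yes r = r
  ... | no ¬r = ⊥-elim (absurd g inj y (λ x e → ¬r (x , e)))
    where
    absurd : ∀ {n} (g : Fin n → Fin n) → (∀ {i j} → g i ≡ g j → i ≡ j) →
             ∀ y → (∀ x → g x ≢ y) → ⊥
    absurd {suc n} g inj y ne = <-irrefl refl (Fin.injective⇒≤ {f = λ x → punchOut {i = y} {j = g x} (λ e → ne x (sym e))}
      (λ {a} {b} e → inj (Fin.punchOut-injective (λ e → ne a (sym e)) (λ e → ne b (sym e)) e)))

bijection⇒word : (f : ℕ → ℕ) → (∀ {i} → i < n → f i < n) →
  (∀ {i j} → i < n → j < n → f i ≡ f j → i ≡ j) →
  ∃ λ (σ : Permutation′ n) → ∀ {i} → i < n → lookupℕ (word σ) i ≡ suc (f i)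
bijection⇒word {n} f bnd inj = let σ , eq = injective⇒permutation g g-inj in
    σ , λ {i} i<n → trans (lookup-word σ i<n)
      (cong suc (trans (cong toℕ (eq _)) (trans (Fin.toℕ-fromℕ< _) (cong f (Fin.toℕ-fromℕ< i<n)))))
  where
  g : Fin n → Fin n
  g i = fromℕ< (bnd (Fin.toℕ<n i))
  g-inj : ∀ {i j} → g i ≡ g j → i ≡ j
  g-inj {i} {j} e = Fin.toℕ-injective (inj (Fin.toℕ<n i) (Fin.toℕ<n j)
    (trans (sym (Fin.toℕ-fromℕ< _)) (trans (cong toℕ e) (Fin.toℕ-fromℕ< _))))

-- Piercing and the greedy sweep

-- The vertices strictly between the up-step and the down-step labelled i are those x with
-- dn x ≤ i < up x; here i is 0-based.
Pierces : ℕ → (ℕ → Bool) → (ℕ → Bool) → Set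
Pierces n s M = ∀ {i} → i < n → ∃ λ x → x < 2 * n × M x ≡ true × dn s x ≤ i × i < up s x

-- The peaks of the bounce path are found by sweeping d from left to right: cur is the label whose
-- down-step produces the next one.
cur    : (ℕ → Bool) → ℕ → ℕ
greedy : (ℕ → Bool) → ℕ → Bool
cur s zero    = 0
cur s (suc x) = if greedy s x then up s x else cur s x
greedy s x = not (s x) ∧ (dn s x ≡ᵇ cur s x)

module Greedy {n : ℕ} {s : ℕ → Bool} (D : IsDyck n s) where
  open Dyck D

  greedy-elim : greedy s x ≡ true → s x ≡ false × dn s x ≡ cur s x
  greedy-elim {x} e with s x
  ... | false = refl , ≡ᵇ≡true⇒≡ e

  greedy-intro : s x ≡ false → dn s x ≡ cur s x → greedy s x ≡ true
  greedy-intro e e′ = cong₂ _∧_ (not-true e) (≡⇒≡ᵇ≡true e′)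

  cur-true : greedy s x ≡ true → cur s (suc x) ≡ up s x
  cur-true e rewrite e = refl

  cur-false : greedy s x ≡ false → cur s (suc x) ≡ cur s x
  cur-false e rewrite e = refl

  cur≤up : ∀ x → cur s x ≤ up s x
  cur≤up zero    = z≤n
  cur≤up (suc x) with greedy s x
  ... | true  = cnt-≤-suc s x
  ... | false = ≤-trans (cur≤up x) (cnt-≤-suc s x)

  cur-≤-suc : ∀ x → cur s x ≤ cur s (suc x)
  cur-≤-suc x with greedy s x
  ... | true  = cur≤up x
  ... | false = ≤-refl

  -- The sweep is never overtaken: a down-step with `dn s x ≡ cur s x` makes `x` greedy, and `cur`
  -- then jumps to `up s x`, which is larger than `dn s x`.
  dn≤cur : ∀ x → x ≤ N → dn s x ≤ cur s x
  dn≤cur zero    h = z≤n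
  dn≤cur (suc x) h = go (s x) refl
    where
    ih = dn≤cur x (<⇒≤ h)
    go : ∀ c → s x ≡ c → dn s (suc x) ≤ cur s (suc x)
    go true e = subst (_≤ cur s (suc x)) (sym (dn-U e)) (≤-trans ih (cur-≤-suc x))
    go false e with m≤n⇒m<n∨m≡n ih
    ... | inj₁ l = subst (_≤ cur s (suc x)) (sym (dn-D e)) (≤-trans l (cur-≤-suc x))
    ... | inj₂ q = subst₂ _≤_ (sym (dn-D e)) (sym (cur-true (greedy-intro e q))) (dn<up-at-D h e)

  -- When the sweep picks `x`, index `cur s x` is about to close. The mark of `M` that pierces it
  -- lies at or before `x`, and after every mark already charged, so each greedy vertex is charged
  -- to a mark of its own.
  greedy-minimal : ∀ {M} → Pierces n s M → cnt (greedy s) N ≤ cnt M N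
  greedy-minimal {M} pierce = let ℓ , ℓ≤ , h , _ = inv N ≤-refl in ≤-trans h (cnt-mono M ℓ≤)
    where
    -- The marks charged so far lie before `ℓ`; no vertex before `ℓ` pierces index `cur s x`.
    inv : ∀ x → x ≤ N → ∃ λ ℓ → ℓ ≤ x × cnt (greedy s) x ≤ cnt M ℓ × (∀ {t} → t < ℓ → up s t ≤ cur s x)
    inv zero h = 0 , z≤n , z≤n , λ ()
    inv (suc x) h with inv x (<⇒≤ h) | greedy s x in g
    ... | ℓ , ℓ≤ , le , bnd | false = ℓ , m≤n⇒m≤1+n ℓ≤ , le , bnd
    ... | ℓ , ℓ≤ , le , bnd | true with greedy-elim g
    ...   | sx , dx with pierce (subst (_< n) dx (dn<n-at-D h sx))
    ...     | t , _ , Mt , t-dn , t-up = suc x , ≤-refl ,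
      ≤-trans (s≤s le) (≤-trans (s≤s (cnt-mono M ℓ≤t)) (≤-trans (≤-reflexive (sym (cnt-true {M} Mt))) (cnt-mono M t<)))
      , λ t<x → cnt-mono s (≤-pred t<x)
      where
      ℓ≤t : ℓ ≤ t
      ℓ≤t = ≮⇒≥ (λ t<ℓ → <⇒≱ t-up (bnd t<ℓ))
      t< : t < suc x
      t< = cnt-reflects-< (not ∘ s) (subst (dn s t <_) (sym (dn-D sx)) (s≤s (subst (dn s t ≤_) (sym dx) t-dn)))

  cur-end : cur s N ≡ n
  cur-end = ≤-antisym (subst (cur s N ≤_) up-end (cur≤up N)) (subst (_≤ cur s N) dn-end (dn≤cur N ≤-refl))

  -- A greedy vertex `y` before `z` would be followed by the down-step of index `c`, which would
  -- give `dn s z > c`.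
  greedy-before : x ≤ z → cur s x ≡ c → dn s z ≤ c → ∀ {y} → x ≤ y → y ≤ z → cur s y ≡ c × (y < z → greedy s y ≡ false)
  greedy-before {x} {z} {c} x≤z cx dz {y} x≤y y≤z = e , λ y<z → unmarked y<z e
    where
    unmarked : ∀ {y} → y < z → cur s y ≡ c → greedy s y ≡ false
    unmarked {y} y<z cy with greedy s y in g
    ... | false = refl
    ... | true = let sy , dy = greedy-elim g in ⊥-elim (<⇒≱
      (cnt-mono-true {not ∘ s} (not-true sy) y<z) (subst (dn s z ≤_) (sym (trans dy cy)) dz))
    stay : ∀ y → x ≤ y → y ≤ z → cur s y ≡ c
    stay y x≤y y≤z with m≤n⇒m<n∨m≡n x≤y
    stay y x≤y y≤z | inj₂ refl = cx
    stay (suc y) x≤y y≤z | inj₁ (s≤s l) = let cy = stay y l (<⇒≤ y≤z) in trans (cur-false (unmarked y≤z cy)) cy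
    e = stay y x≤y y≤z

-- The bounce path and the greedy vertices

∧-elim : ∀ p {q} → p ∧ q ≡ true → p ≡ true × q ≡ true
∧-elim true e = refl , e

findUp-unique : ∀ f w x j j₀ → (height w (x + j₀) ≡ᵇ j₀) ∧ isDown (stepAt w (x + j₀)) ≡ true →
  (∀ {i} → (height w (x + i) ≡ᵇ i) ∧ isDown (stepAt w (x + i)) ≡ true → i ≡ j₀) →
  j ≤ j₀ → j₀ < j + f → findUp f w x j ≡ just j₀
findUp-unique zero w x j j₀ h u j≤ <f = ⊥-elim (<⇒≱ <f (subst (_≤ j₀) (sym (+-identityʳ j)) j≤))
findUp-unique (suc f) w x j j₀ h u j≤ <f with (height w (x + j) ≡ᵇ j) ∧ isDown (stepAt w (x + j)) in e
... | true = cong just (u e)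
... | false = findUp-unique f w x (suc j) j₀ h u
    (≤∧≢⇒< j≤ (λ { refl → true≢false h e })) (subst (j₀ <_) (+-suc j f) <f)

isDown-elim : ∀ {r} → isDown r ≡ true → r ≡ just false
isDown-elim {just false} _ = refl

module Bounce {n : ℕ} (d : DyckPath n) where
  private
    w = path d
    s = at w
  open Dyck (at-dyck d)
  open Greedy (at-dyck d)

  private
    <w : ∀ {k} → k < N → k < length w
    <w = subst (_ <_) (sym (len d))
    <w⁻¹ : ∀ {k} → k < length w → k < N
    <w⁻¹ = subst (_ <_) (len d)

  -- A point of `d` at abscissa `2c + i` and height `i` has exactly `c` down-steps behind it. Hence
  -- the ascent of the bounce path from `(2c, 0)` can stop only at the down-step of index `c`, which
  -- is at `z`.
  findUp-cur : z < N → s z ≡ false → dn s z ≡ c → up s z ≡ c + j → 1 ≤ j → findUp (length w) w (2 * c) 1 ≡ just j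
  findUp-cur {z} {c} {j} z<N sz dz uz 1≤j = findUp-unique (length w) w (2 * c) 1 j
      (cong₂ _∧_ (≡⇒≡ᵇ≡true hj) (cong isDown (trans (cong (stepAt w) zeq) (trans (stepAt-at w (<w z<N)) (cong just sz)))))
      unique 1≤j (s≤s (≤-trans (m≤n+m j (2 * c)) (≤-trans (≤-reflexive zeq) (<⇒≤ (<w z<N)))))
    where
    2c+ : ∀ i → 2 * c + i ≡ (c + i) + c
    2c+ i = trans (cong (_+ i) (2*-+ c)) (trans (+-assoc c c i) (trans (cong (c +_) (+-comm c i)) (sym (+-assoc c i c))))
    zeq : 2 * c + j ≡ z
    zeq = trans (2c+ j) (trans (cong₂ _+_ (sym uz) (sym dz)) (up+dn z))
    hj : height w (2 * c + j) ≡ j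
    hj = +-cancelʳ-≡ c _ _ (trans (cong₂ _+_ (cong (height w) zeq) (sym dz))
           (trans (height-up-dn d (<⇒≤ z<N)) (trans uz (+-comm c j))))
    unique : ∀ {i} → (height w (2 * c + i) ≡ᵇ i) ∧ isDown (stepAt w (2 * c + i)) ≡ true → i ≡ j
    unique {i} e with ∧-elim (height w (2 * c + i) ≡ᵇ i) e
    ... | e₁ , e₂ with stepAt-just w (isDown-elim e₂)
    ...   | y<w , sy = +-cancelˡ-≡ (2 * c) _ _ (trans (≤-antisym (≮⇒≥ z≮y) (≮⇒≥ y≮z)) (sym zeq))
      where
      yᵢ = 2 * c + i
      uy : i + dn s yᵢ ≡ up s yᵢ
      uy = trans (cong (_+ dn s yᵢ) (sym (≡ᵇ≡true⇒≡ e₁))) (height-up-dn d (<⇒≤ (<w⁻¹ y<w)))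
      2dn : 2 * dn s yᵢ ≡ 2 * c
      2dn = +-cancelʳ-≡ i _ _ (trans (cong (_+ i) (2*-+ (dn s yᵢ))) (trans (+-assoc (dn s yᵢ) _ _)
        (trans (+-comm (dn s yᵢ) _) (trans (cong (_+ dn s yᵢ) (trans (+-comm (dn s yᵢ) i) uy)) (up+dn yᵢ)))))
      dy : dn s yᵢ ≡ dn s z
      dy = trans (*-cancelˡ-≡ _ _ 2 2dn) (sym dz)
      z≮y : ¬ z < yᵢ
      z≮y l = <-irrefl (sym dy) (cnt-mono-true {not ∘ s} (not-true sz) l)
      y≮z : ¬ yᵢ < z
      y≮z l = <-irrefl dy (cnt-mono-true {not ∘ s} (not-true sy) l)

  private
    finished : x ≤ N → cur s x ≡ c → n ≤ c → cnt (greedy s) N ≡ cnt (greedy s) x + 0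
    finished x≤ cx n≤c = trans (cnt-const (greedy s) x≤
      (λ p q → proj₂ (greedy-before x≤ cx (≤-trans (≤-reflexive dn-end) n≤c) p (<⇒≤ q)) q)) (sym (+-identityʳ _))

  -- The bounce path at `(2c, 0)` matches the sweep in a state with `cur s x ≡ c`: the next greedy
  -- vertex is the down-step of index `c`, and both move on to `c + j = up s z`. As `j` is positive,
  -- every bounce increases `c`, so fuel `f` with `n ≤ c + f` suffices.
  bounceCount-greedy : ∀ f x c → x ≤ N → cur s x ≡ c → n ≤ c + f →
    cnt (greedy s) N ≡ cnt (greedy s) x + bounceCount f w (2 * c)
  bounceCount-greedy zero x c x≤ cx n≤ = finished x≤ cx (subst (n ≤_) (+-identityʳ c) n≤)
  bounceCount-greedy (suc f) x c x≤ cx n≤ with 2 * c <ᵇ length w in e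
  ... | false = finished x≤ cx (*-cancelˡ-≤ 2 (subst (_≤ 2 * c) (len d) (<ᵇ≡false⇒≥ e)))
  ... | true with cnt-find (not ∘ s) N (subst (c <_) (sym dn-end) (*-cancelˡ-< 2 c n (<w⁻¹ (<ᵇ≡true⇒< e))))
  ...   | z , z<N , sz′ , dz with m≤n⇒∃[o]m+o≡n c<up
        where
        c<up : c < up s z
        c<up = subst (_< up s z) dz (dn<up-at-D z<N (not-true⁻¹ sz′))
  ...     | i , uz rewrite findUp-cur z<N (not-true⁻¹ sz′) dz (sym (trans (+-suc c i) uz)) (s≤s z≤n) = begin
      cnt (greedy s) N
        ≡⟨ bounceCount-greedy f (suc z) (c + suc i) z<N (trans (cur-true gz) (sym (trans (+-suc c i) uz))) n≤′ ⟩
      cnt (greedy s) (suc z) + bounceCount f w (2 * (c + suc i))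
        ≡⟨ cong₂ _+_ (trans (cnt-true {greedy s} gz) (cong suc same)) (cong (bounceCount f w) (*-distribˡ-+ 2 c (suc i))) ⟩
      suc (cnt (greedy s) x) + bounceCount f w (2 * c + 2 * suc i)
        ≡⟨ +-suc _ _ ⟨
      cnt (greedy s) x + suc (bounceCount f w (2 * c + 2 * suc i)) ∎
    where
    open ≡-Reasoning
    sz = not-true⁻¹ sz′
    x≤z : x ≤ z
    x≤z = ≮⇒≥ (λ z<x → <⇒≱ (cnt-mono-true {not ∘ s} sz′ z<x) (≤-trans (dn≤cur x x≤) (≤-reflexive (trans cx (sym dz)))))
    before = greedy-before x≤z cx (≤-reflexive dz)
    gz : greedy s z ≡ true
    gz = greedy-intro sz (trans dz (sym (proj₁ (before x≤z ≤-refl))))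
    same : cnt (greedy s) z ≡ cnt (greedy s) x
    same = cnt-const (greedy s) x≤z (λ p q → proj₂ (before p (<⇒≤ q)) q)
    n≤′ : n ≤ (c + suc i) + f
    n≤′ = ≤-trans n≤ (≤-trans (+-monoʳ-≤ c (+-monoˡ-≤ f (s≤s (z≤n {i})))) (≤-reflexive (sym (+-assoc c (suc i) f))))

  bpk-greedy : bpk w ≡ cnt (greedy s) N
  bpk-greedy = sym (bounceCount-greedy (length w) 0 0 z≤n refl (subst (n ≤_) (sym (len d)) (m≤m+n n _)))

-- Segments between consecutive marks

≤⇒≤ᵇ≡true : m ≤ n → (m ≤ᵇ n) ≡ true
≤⇒≤ᵇ≡true {zero}  h = refl
≤⇒≤ᵇ≡true {suc m} h = <⇒<ᵇ≡true h

>⇒≤ᵇ≡false : n < m → (m ≤ᵇ n) ≡ false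
>⇒≤ᵇ≡false {m = suc m} h = ≥⇒<ᵇ≡false (≤-pred h)

module Segments (N : ℕ) (M : ℕ → Bool) where

  -- The ends `0` and `N` bound segments whether or not `M` marks them.
  record Seg (y z : ℕ) : Set where
    constructor mkSeg
    field
      y<z  : y < z
      z≤N  : z ≤ N
      y-mk : y ≡ 0 ⊎ M y ≡ true
      z-mk : z ≡ N ⊎ M z ≡ true
      none : ∀ {x} → y < x → x < z → M x ≡ false

  prev : ℕ → ℕ
  prev zero    = 0
  prev (suc k) = if M (suc k) then suc k else prev k

  -- The first argument is the distance to `N`, so that an unsuccessful search stops exactly there.
  next-from : ℕ → ℕ → ℕ
  next-from zero    x = x
  next-from (suc m) x = if M x then x else next-from m (suc x)

  next : ℕ → ℕ
  next k = next-from (N ∸ suc k) (suc k)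

  prev-spec : ∀ k → prev k ≤ k × (prev k ≡ 0 ⊎ M (prev k) ≡ true) × (∀ {x} → prev k < x → x ≤ k → M x ≡ false)
  prev-spec zero = z≤n , inj₁ refl , λ p q → ⊥-elim (<⇒≱ p q)
  prev-spec (suc k) with M (suc k) in e
  ... | true  = ≤-refl , inj₂ e , λ p q → ⊥-elim (<⇒≱ p q)
  ... | false with prev-spec k
  ...   | le , mk , clear = m≤n⇒m≤1+n le , mk , go
    where
    go : ∀ {x} → prev k < x → x ≤ suc k → M x ≡ false
    go p q with m≤n⇒m<n∨m≡n q
    ... | inj₁ q′   = clear p (≤-pred q′)
    ... | inj₂ refl = e

  next-from-spec : ∀ m x → let z = next-from m x in
    x ≤ z × z ≤ x + m × (z ≡ x + m ⊎ M z ≡ true) × (∀ {y} → x ≤ y → y < z → M y ≡ false)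
  next-from-spec zero x = ≤-refl , m≤m+n x 0 , inj₁ (sym (+-identityʳ x)) , λ p q → ⊥-elim (<⇒≱ q p)
  next-from-spec (suc m) x with M x in e
  ... | true  = ≤-refl , m≤m+n x _ , inj₂ e , λ p q → ⊥-elim (<⇒≱ q p)
  ... | false with next-from-spec m (suc x)
  ...   | lo , hi , mk , clear rewrite +-suc x m = <⇒≤ lo , hi , mk , go
    where
    go : ∀ {y} → x ≤ y → y < next-from m (suc x) → M y ≡ false
    go p q with m≤n⇒m<n∨m≡n p
    ... | inj₁ p′   = clear p′ q
    ... | inj₂ refl = e

  seg : k < N → Seg (prev k) (next k) × prev k ≤ k × k < next k
  seg {k} k<N with prev-spec k | next-from-spec (N ∸ suc k) (suc k)
  ... | p≤ , p-mk , p-none | lo , hi , n-mk , n-none rewrite m+[n∸m]≡n k<N =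
    mkSeg (≤-<-trans p≤ lo) hi p-mk n-mk none , p≤ , lo
    where
    none : ∀ {x} → prev k < x → x < next k → M x ≡ false
    none {x} p q with x ≤? k
    ... | yes x≤k = p-none p x≤k
    ... | no  x≰k = n-none (≰⇒> x≰k) q

  private
    y≮y : Seg y z → Seg p q → k < z → p ≤ k → ¬ y < p
    y≮y s t k<z p≤k y<p with Seg.y-mk t
    ... | inj₁ refl = n≮0 y<p
    ... | inj₂ e = true≢false e (Seg.none s y<p (≤-<-trans p≤k k<z))

    z≮z : Seg y z → Seg p q → y ≤ k → k < q → ¬ q < z
    z≮z s t y≤k k<q q<z with Seg.z-mk t
    ... | inj₁ refl = <⇒≱ q<z (Seg.z≤N s)
    ... | inj₂ e = true≢false e (Seg.none s (≤-<-trans y≤k k<q) q<z)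

  seg-unique : Seg y z → Seg p q → y ≤ k → k < z → p ≤ k → k < q → y ≡ p × z ≡ q
  seg-unique s t a b c d =
    ≤-antisym (≮⇒≥ (y≮y t s d a)) (≮⇒≥ (y≮y s t b c)) , ≤-antisym (≮⇒≥ (z≮z s t a d)) (≮⇒≥ (z≮z t s c b))

  seg-before : suc k < N → M (suc k) ≡ true → Seg (prev k) (suc k)
  seg-before {k} k< e with seg (<-trans (n<1+n k) k<)
  ... | s , p≤ , lo with m≤n⇒m<n∨m≡n lo
  ...   | inj₁ l = ⊥-elim (true≢false e (Seg.none s (s≤s p≤) l))
  ...   | inj₂ q = subst (Seg (prev k)) (sym q) s

  seg-after : k < N → M k ≡ true → Seg k (next k)
  seg-after {k} k< e with seg k<
  ... | s , p≤ , lo with m≤n⇒m<n∨m≡n p≤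
  ...   | inj₁ l = ⊥-elim (true≢false e (Seg.none s l lo))
  ...   | inj₂ q = subst (λ y → Seg y (next k)) q s

-- Inscribed paths and the sorted envelope

-- The conditions of `InB` except the number of peaks. At a fixed abscissa, comparing heights
-- amounts to comparing up-counts, and the axis is where `up` and `dn` agree.
record Inscribed (n : ℕ) (d b : ℕ → Bool) : Set where
  field
    under   : ∀ {k} → k ≤ 2 * n → up b k ≤ up d k
    peaks   : ∀ {k} → suc k < 2 * n → b k ≡ true → b (suc k) ≡ false → up b (suc k) ≡ up d (suc k)
    valleys : ∀ {k} → suc k < 2 * n → b k ≡ false → b (suc k) ≡ true →
      ((d k ≡ false × d (suc k) ≡ true) × up b (suc k) ≡ up d (suc k)) ⊎ up b (suc k) ≡ dn b (suc k)

module Envelope {n : ℕ} {s : ℕ → Bool} (D : IsDyck n s) (M : ℕ → Bool) where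
  open Dyck D
  open Segments N M

  -- The valley of the sorted segment has up-count `up s y` and down-count `dn s z`. Thus `covers`
  -- keeps it above the axis, `up-str` and `dn-str` turn the marks into peaks, and `shape` says that
  -- `d` was sorted already wherever the valley is off the axis.
  record Admissible : Set where
    field
      covers : Seg y z → dn s z ≤ up s y
      up-str : Seg y z → z < N → up s y < up s z
      dn-str : Seg y z → 0 < y → dn s y < dn s z
      shape  : Seg y z → dn s z < up s y → y ≤ p → p < q → q < z → s p ≡ true → s q ≡ false → ⊥

  module _ (A : Admissible) where
    open Admissible A

    -- On each segment the steps of d are sorted, all down-steps first; the valley is at
    -- abscissa up y + dn z.
    env : ℕ → Bool
    env k = (up s (prev k) + dn s (next k)) ≤ᵇ k

    valley : ℕ → ℕ → ℕ
    valley y z = up s y + dn s z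

    env-seg : Seg y z → y ≤ k → k < z → env k ≡ (valley y z ≤ᵇ k)
    env-seg {k = k} S y≤ <z with seg (<-≤-trans <z (Seg.z≤N S))
    ... | T , p≤ , <q with seg-unique S T y≤ <z p≤ <q
    ...   | refl , refl = refl

    env-D : Seg y z → y ≤ k → k < z → k < valley y z → env k ≡ false
    env-D S a b h = trans (env-seg S a b) (>⇒≤ᵇ≡false h)

    env-U : Seg y z → y ≤ k → k < z → valley y z ≤ k → env k ≡ true
    env-U S a b h = trans (env-seg S a b) (≤⇒≤ᵇ≡true h)

    y≤valley : Seg y z → y ≤ valley y z
    y≤valley {y} {z} S = subst (_≤ valley y z) (up+dn y) (+-monoʳ-≤ (up s y) (cnt-mono (not ∘ s) (<⇒≤ (Seg.y<z S))))

    valley≤z : Seg y z → valley y z ≤ z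
    valley≤z {y} {z} S = subst (valley y z ≤_) (up+dn z) (+-monoˡ-≤ (dn s z) (cnt-mono s (<⇒≤ (Seg.y<z S))))

    private
      env-step : Seg y z → y ≤ k → k < z → up env k ≡ up s y + (k ∸ valley y z) →
                 up env (suc k) ≡ up s y + (suc k ∸ valley y z)
      env-step {y} {z} {k} S a b e with valley y z ≤? k
      ... | yes l = trans (cnt-true {env} {k} (env-U S a b l)) (trans (cong suc e)
              (trans (sym (+-suc (up s y) _)) (cong (up s y +_) (sym (+-∸-assoc 1 l)))))
      ... | no ¬l = trans (cnt-false {env} {k} (env-D S a b (≰⇒> ¬l))) (trans e (cong (up s y +_)
              (trans (m≤n⇒m∸n≡0 (<⇒≤ (≰⇒> ¬l))) (sym (m≤n⇒m∸n≡0 (≰⇒> ¬l))))))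

    -- Truncated subtraction serves both halves of the segment: it vanishes up to the valley and
    -- counts the up-steps after it.
    up-env : ∀ k → Seg y z → y ≤ k → k ≤ z → up env k ≡ up s y + (k ∸ valley y z)
    up-env {y} {z} zero S z≤n b = sym (cong (0 +_) (0∸n≡0 (valley 0 z)))
    up-env {y} {z} (suc k) S a b with m≤n⇒m<n∨m≡n a
    ... | inj₁ a′ = env-step S (≤-pred a′) b (up-env k S (≤-pred a′) (<⇒≤ b))
    ... | inj₂ refl with Seg.y-mk S
    -- The mark `y` is also the right end of the preceding segment, where the formula for that
    -- segment gives `up s y` again.
    ...   | inj₂ My = trans (env-step S′ p≤ ≤-refl (up-env k S′ p≤ (n≤1+n k)))
            (trans (subst (λ t → up s (prev k) + (t ∸ valley (prev k) (suc k)) ≡ up s (suc k)) (up+dn (suc k))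
                     (refill (up s (prev k)) (dn s (suc k)) (cnt-mono s (m≤n⇒m≤1+n p≤))))
                   (trans (sym (+-identityʳ _)) (cong (up s (suc k) +_) (sym (m≤n⇒m∸n≡0 (y≤valley S))))))
      where
      S′ = seg-before (<-≤-trans (Seg.y<z S) (Seg.z≤N S)) My
      p≤ : prev k ≤ k
      p≤ = proj₁ (prev-spec k)
      refill : ∀ a e {u} → a ≤ u → a + ((u + e) ∸ (a + e)) ≡ u
      refill a e {u} a≤u = trans (cong (a +_) ([m+n]∸[o+n]≡m∸o u e a)) (m+[n∸m]≡n a≤u)
        where
        [m+n]∸[o+n]≡m∸o : ∀ m n o → (m + n) ∸ (o + n) ≡ m ∸ o
        [m+n]∸[o+n]≡m∸o m n o = trans (cong₂ _∸_ (+-comm m n) (+-comm o n)) ([m+n]∸[m+o]≡n∸o n m o)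

    up-env-D : Seg y z → y ≤ k → k ≤ z → k ≤ valley y z → up env k ≡ up s y
    up-env-D {y} {k = k} S a b h = trans (up-env k S a b) (trans (cong (up s y +_) (m≤n⇒m∸n≡0 h)) (+-identityʳ _))

    dn-env-U : Seg y z → y ≤ k → k ≤ z → valley y z ≤ k → dn env k ≡ dn s z
    dn-env-U {y} {z} {k} S a b h = +-cancelˡ-≡ (up env k) _ _ (trans (cnt-not env k) (sym
      (trans (cong (_+ dn s z) (up-env k S a b)) (trans (+-assoc (up s y) _ _)
        (trans (cong (up s y +_) (+-comm _ (dn s z))) (trans (sym (+-assoc (up s y) (dn s z) _)) (m+[n∸m]≡n h)))))))

    up-env-mark : k < N → k ≡ 0 ⊎ M k ≡ true → up env k ≡ up s k
    up-env-mark {k} k< (inj₁ refl) = refl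
    up-env-mark {k} k< (inj₂ e) = let S = seg-after k< e in up-env-D S ≤-refl (<⇒≤ (Seg.y<z S)) (y≤valley S)

    private
      inSeg : ∀ {k} → k < N → ∃ λ y → ∃ λ z → Seg y z × y ≤ k × k < z
      inSeg k< = _ , _ , seg k<

      -- Before the valley the up-count is frozen at `up s y`, after it the down-count is frozen at
      -- `dn s z`; monotonicity of the counts of `d` then puts the envelope under `d`, and `covers`
      -- puts it above the axis.
      bounds : k ≤ N → up env k ≤ up s k × dn env k ≤ up env k
      bounds {zero} k≤ = z≤n , z≤n
      bounds {suc k} k≤ with inSeg k≤
      ... | y , z , S , a , b with ≤-total (suc k) (valley y z)
      ...   | inj₁ h = subst (_≤ up s (suc k)) (sym eu) (cnt-mono s (m≤n⇒m≤1+n a)) ,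
              ≤-trans (+-cancelˡ-≤ (up s y) _ _ (subst (_≤ valley y z)
                        (sym (trans (cong (_+ dn env (suc k)) (sym eu)) (cnt-not env (suc k)))) h))
                      (≤-trans (covers S) (≤-reflexive (sym eu)))
        where eu = up-env-D S (m≤n⇒m≤1+n a) b h
      ...   | inj₂ h = +-cancelʳ-≤ (dn env (suc k)) _ _
                (subst₂ _≤_ (sym (cnt-not env (suc k))) refl (subst (_≤ up s (suc k) + dn env (suc k)) (up+dn (suc k))
                  (+-monoʳ-≤ (up s (suc k)) (subst (dn s (suc k) ≤_) (sym ed) (cnt-mono (not ∘ s) b))))) ,
              subst (_≤ up env (suc k)) (sym ed) (≤-trans (covers S)
                (subst (up s y ≤_) (sym (up-env (suc k) S (m≤n⇒m≤1+n a) b)) (m≤m+n _ _)))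
        where ed = dn-env-U S (m≤n⇒m≤1+n a) b h

    env-dyck : IsDyck n env
    env-dyck = record { dn≤up = proj₂ ∘ bounds ; up-end = end n refl }
      where
      end : ∀ m → m ≡ n → up env N ≡ n
      end zero refl = refl
      -- The implicit argument is `N ∸ 1` in the form to which `2 * suc m` reduces; the segment of
      -- the last step ends at `N`.
      end (suc m) refl with inSeg {m + 1 * suc m} ≤-refl
      ... | y , z , S , a , b with ≤-antisym (Seg.z≤N S) b
      ...   | refl = +-cancelʳ-≡ (dn s N) _ _ (trans (cong (up env N +_) (sym (dn-env-U S (<⇒≤ (Seg.y<z S)) ≤-refl (valley≤z S))))
              (trans (cnt-not env N) (trans (sym (up+dn N)) (cong (_+ dn s N) up-end))))

    -- By `up-str` the valley of the left segment comes strictly before the mark, by `dn-str` that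
    -- of the right segment strictly after it.
    peak-at-mark : suc k < N → M (suc k) ≡ true → env k ≡ true × env (suc k) ≡ false
    peak-at-mark {k} k< e = env-U S p≤ ≤-refl (≤-pred <S) , env-D S′ ≤-refl (Seg.y<z S′) <S′
      where
      S = seg-before k< e
      p≤ = proj₁ (prev-spec k)
      S′ = seg-after k< e
      <S : valley (prev k) (suc k) < suc k
      <S = subst (valley (prev k) (suc k) <_) (up+dn (suc k)) (+-monoˡ-< (dn s (suc k)) (up-str S k<))
      <S′ : suc k < valley (suc k) (next (suc k))
      <S′ = subst (_< valley (suc k) (next (suc k))) (up+dn (suc k)) (+-monoʳ-< (up s (suc k)) (dn-str S′ (s≤s z≤n)))

    no-peak-off-marks : suc k < N → M (suc k) ≡ false → env k ≡ false ⊎ env (suc k) ≡ true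
    no-peak-off-marks {k} k< e with inSeg k<
    ... | y , z , S , a , b with m≤n⇒m<n∨m≡n a
    ...   | inj₂ refl = case Seg.y-mk S of λ { (inj₂ My) → ⊥-elim (true≢false My e) }
    ...   | inj₁ a′ with valley y z ≤? suc k
    ...     | yes h = inj₂ (env-U S a b h)
    ...     | no ¬h = inj₁ (env-D S (≤-pred a′) (<-trans (n<1+n k) b) (<-trans (n<1+n k) (≰⇒> ¬h)))

    peak-env : suc k < N → peak env k ≡ M (suc k)
    peak-env {k} k< = go (M (suc k)) refl
      where
      go : ∀ c → M (suc k) ≡ c → peak env k ≡ M (suc k)
      go true e = let u , v = peak-at-mark k< e in trans (cong₂ _∧_ u (not-true v)) (sym e)
      go false e with no-peak-off-marks k< e
      ... | inj₁ u = trans (cong (_∧ not (env (suc k))) u) (sym e)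
      ... | inj₂ u = trans (cong (λ c → env k ∧ not c) u) (trans (∧-zeroʳ (env k)) (sym e))

    env-inscribed : Inscribed n s env
    env-inscribed = record
      { under   = proj₁ ∘ bounds
      ; peaks   = λ {k} k< e e′ → up-env-mark k< (inj₂ (trans (sym (peak-env k<)) (cong₂ _∧_ e (not-true e′))))
      ; valleys = vl }
      where
      vl : suc k < N → env k ≡ false → env (suc k) ≡ true →
        ((s k ≡ false × s (suc k) ≡ true) × up env (suc k) ≡ up s (suc k)) ⊎ up env (suc k) ≡ dn env (suc k)
      vl {k} k< e e′ with inSeg k<
      ... | y , z , S , a , b with m≤n⇒m<n∨m≡n a
      ...   | inj₂ refl with Seg.y-mk S
      ...     | inj₂ My = ⊥-elim (true≢false (trans (peak-env k<) My) (cong (_∧ not (env (suc k))) e))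
      vl {k} k< e e′ | y , z , S , a , b | inj₁ a′ with ≤-antisym (≮⇒≥ k≮) (≮⇒≥ ≮k)
        where
        k≮ : ¬ suc k < valley y z
        k≮ h = true≢false e′ (env-D S a b h)
        ≮k : ¬ valley y z < suc k
        ≮k h = true≢false (env-U S (≤-pred a′) (<-trans (n<1+n k) b) (≤-pred h)) e
      ...     | c≡ with m≤n⇒m<n∨m≡n (covers S)
      ...       | inj₂ q = inj₂ (trans (up-env-D S a (<⇒≤ b) (≤-reflexive (sym c≡)))
                    (trans (sym q) (sym (dn-env-U S a (<⇒≤ b) (≤-reflexive c≡)))))
      ...       | inj₁ l = inj₁ ((sk , sk′) , trans (up-env-D S a (<⇒≤ b) (≤-reflexive (sym c≡))) (sym up≡))
        where
        y≤k = ≤-pred a′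
        -- The valley is at `suc k`. An up-step of `d` at `k` would leave a down-step of the segment
        -- to come later, against `shape`; an up-step earlier in the segment is excluded by the
        -- down-step at `k`. So all `dn s z` down-steps are used up at the valley and `d` must rise
        -- from it.
        balance : up s (suc k) + dn s (suc k) ≡ up s y + dn s z
        balance = trans (up+dn (suc k)) (sym c≡)
        sk : s k ≡ false
        sk with s k in t
        ... | false = refl
        ... | true = ⊥-elim (<⇒≢ (+-mono-<-≤ upy< dnz≤) (sym balance))
          where
          upy< : up s y < up s (suc k)
          upy< = ≤-<-trans (cnt-mono s y≤k) (subst (up s k <_) (sym (up-U t)) ≤-refl)
          dnz≤ : dn s z ≤ dn s (suc k)
          dnz≤ = ≮⇒≥ λ h → let q , q<z , sq , dq = cnt-find (not ∘ s) z h in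
            shape S l y≤k (k<q sq dq) q<z t (not-true⁻¹ sq)
            where
            k<q : ∀ {q} → not (s q) ≡ true → dn s q ≡ dn s (suc k) → k < q
            k<q sq dq = ≤∧≢⇒<
              (≤-pred (cnt-reflects-< (not ∘ s) (subst₂ _<_ (trans dq (dn-U t)) (sym (cnt-true {not ∘ s} sq)) ≤-refl)))
              (λ { refl → true≢false t (not-true⁻¹ sq) })
        up≡ : up s (suc k) ≡ up s y
        up≡ = trans (up-D sk) (≤-antisym (≮⇒≥ h) (cnt-mono s y≤k))
          where
          h : ¬ up s y < up s k
          h lt = let p , p<k , sp , upp = cnt-find s k lt in
            shape S l (≤-pred (cnt-reflects-< s (subst (up s y <_) (trans (cong suc (sym upp)) (sym (up-U sp))) ≤-refl)))
              p<k (<-trans (n<1+n k) b) sp sk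
        sk′ : s (suc k) ≡ true
        sk′ with s (suc k) in t
        ... | true = refl
        ... | false = ⊥-elim (<⇒≱ (subst (_< dn s (suc (suc k)))
                (+-cancelˡ-≡ (up s y) _ _ (trans (cong (_+ dn s (suc k)) (sym up≡)) balance))
                (subst (dn s (suc k) <_) (sym (dn-D t)) ≤-refl)) (cnt-mono (not ∘ s) b))

-- The envelope of the greedy vertices

module _ {n : ℕ} {s : ℕ → Bool} (D : IsDyck n s) where
  open Dyck D
  open Greedy D
  open Segments N (greedy s)
  open Envelope D (greedy s) using (Admissible)

  cur-seg : Seg y z → cur s z ≡ up s y
  cur-seg {y} {z} S = stay z (Seg.y<z S) ≤-refl
    where
    start : y ≡ 0 ⊎ greedy s y ≡ true → cur s (suc y) ≡ up s y
    start (inj₂ e) = cur-true e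
    start (inj₁ refl) with greedy s 0
    ... | true  = refl
    ... | false = refl
    stay : ∀ x → y < x → x ≤ z → cur s x ≡ up s y
    stay (suc x) (s≤s l) x≤z with m≤n⇒m<n∨m≡n l
    ... | inj₂ refl = start (Seg.y-mk S)
    ... | inj₁ l′   = trans (cur-false (Seg.none S l′ x≤z)) (stay x l′ (<⇒≤ x≤z))

  -- All valleys of this envelope lie on the axis: it is the bounce path.
  greedy-tight : Seg y z → dn s z ≡ up s y
  greedy-tight S with Seg.z-mk S
  ... | inj₁ refl = trans dn-end (trans (sym cur-end) (cur-seg S))
  ... | inj₂ e    = trans (proj₂ (greedy-elim e)) (cur-seg S)

  greedy-admissible : Admissible
  greedy-admissible = record
    { covers = ≤-reflexive ∘ greedy-tight
    ; up-str = λ S z<N → case Seg.z-mk S of λ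
        { (inj₁ refl) → ⊥-elim (<-irrefl refl z<N)
        ; (inj₂ e) → subst (_< _) (greedy-tight S) (dn<up-at-D z<N (proj₁ (greedy-elim e))) }
    ; dn-str = λ S 0<y → case Seg.y-mk S of λ
        { (inj₁ refl) → ⊥-elim (<-irrefl refl 0<y)
        ; (inj₂ e) → subst (_ <_) (sym (greedy-tight S))
            (dn<up-at-D (<-≤-trans (Seg.y<z S) (Seg.z≤N S)) (proj₁ (greedy-elim e))) }
    ; shape  = λ S l → ⊥-elim (<-irrefl (greedy-tight S) l) }

-- The marks of a permutation

-- Shifted by one against `ascents`: the letters of steps `k` and `suc k` meet at vertex `suc k`.
marks : (ℕ → ℕ) → (ℕ → Bool) → ℕ → Bool
marks f s zero    = false
marks f s (suc k) = ascents f s k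

module Marks {n : ℕ} {s : ℕ → Bool} (D : IsDyck n s) (f : ℕ → ℕ) where
  open Dyck D
  open Greedy D
  open Segments N (marks f s)
  open Envelope D (marks f s) using (Admissible)

  decreasing : (∀ {x} → y < x → x < z → marks f s x ≡ false) → y ≤ p → p < q → q < z →
               f (ix s q) < f (ix s p)
  decreasing {q = suc q} none y≤p p<q q<z with m≤n⇒m<n∨m≡n (≤-pred p<q)
  ... | inj₂ refl = <ᵇ≡true⇒< (not-false⁻¹ (none (s≤s y≤p) q<z))
  ... | inj₁ p<q′ = <-trans (<ᵇ≡true⇒< (not-false⁻¹ (none (s≤s (≤-trans y≤p (<⇒≤ p<q′))) q<z)))
                            (decreasing none y≤p p<q′ (<⇒≤ q<z))

  -- The up-step `p` and the down-step `q` of index `i` read the same letter, so some vertex after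
  -- `p` and not after `q` is marked; any such vertex pierces `i`.
  marks-pierce : Pierces n s (marks f s)
  marks-pierce {i} i<n with cnt-find s N (subst (i <_) (sym up-end) i<n)
                          | cnt-find (not ∘ s) N (subst (i <_) (sym dn-end) i<n)
  ... | p , p<N , sp , up-p | q , q<N , sq′ , dn-q with anyMark (suc q)
    where
    anyMark : ∀ m → (∃ λ x → p < x × x < m × marks f s x ≡ true) ⊎ (∀ {x} → p < x → x < m → marks f s x ≡ false)
    anyMark zero = inj₂ λ _ ()
    anyMark (suc m) with anyMark m
    ... | inj₁ (x , a , b , c) = inj₁ (x , a , m<n⇒m<1+n b , c)
    ... | inj₂ none with p <? m | marks f s m in e
    ...   | yes p<m | true  = inj₁ (m , p<m , ≤-refl , e)
    ...   | yes p<m | false = inj₂ λ a b → case m≤n⇒m<n∨m≡n (≤-pred b) of λ { (inj₁ b′) → none a b′ ; (inj₂ refl) → e }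
    ...   | no p≮m  | _     = inj₂ λ a b → ⊥-elim (p≮m (<-≤-trans a (≤-pred b)))
  ...   | inj₁ (x , p<x , x≤q , e) = x , ≤-<-trans (≤-pred x≤q) q<N , e ,
      subst (dn s x ≤_) dn-q (cnt-mono (not ∘ s) (≤-pred x≤q)) ,
      subst (_< up s x) up-p (cnt-mono-true {s} sp p<x)
  ...   | inj₂ none = ⊥-elim (<-irrefl (cong f (trans (ix-D D sq) (trans dn-q (trans (sym up-p) (sym (ix-U D sp))))))
                        (decreasing none ≤-refl p<q ≤-refl))
    where
    sq = not-true⁻¹ sq′
    p<q : p < q
    p<q = cnt-reflects-< s (subst (_< up s q) (trans dn-q (sym up-p)) (dn<up-at-D q<N sq))

  greedy≤marks : cnt (greedy s) N ≤ cnt (marks f s) N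
  greedy≤marks = greedy-minimal marks-pierce

  module Minimal (minimal : cnt (marks f s) N ≤ cnt (greedy s) N) where

    -- If the labels pierced at x were also pierced at y or z, the mark x could be dropped.
    irredundant : y < x → x < z → z ≤ N → marks f s x ≡ true →
      y ≡ 0 ⊎ marks f s y ≡ true → z ≡ N ⊎ marks f s z ≡ true → up s y < dn s z
    irredundant {y} {x} {z} y<x x<z z≤N Mx My Mz = ≰⇒> λ le →
      <⇒≱ (cnt-strict {M′} {marks f s} N (λ {t} → sub {t}) (<-≤-trans x<z z≤N) M′x Mx)
          (≤-trans minimal (greedy-minimal (pierce le)))
      where
      M′ : ℕ → Bool
      M′ t = marks f s t ∧ not (t ≡ᵇ x)
      sub : ∀ {t} → M′ t ≡ true → marks f s t ≡ true
      sub {t} e = proj₁ (∧-elim (marks f s t) e)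
      M′x : M′ x ≡ false
      M′x rewrite ≡⇒≡ᵇ≡true {x} refl | Mx = refl
      M′-intro : ∀ {t} → t ≢ x → marks f s t ≡ true → M′ t ≡ true
      M′-intro {t} t≢x e with t ≡ᵇ x in q
      ... | true  = ⊥-elim (t≢x (≡ᵇ≡true⇒≡ q))
      ... | false rewrite e = refl
      pierce : dn s z ≤ up s y → Pierces n s M′
      pierce le {i} i<n with marks-pierce i<n
      ... | t , t<N , Mt , lo , hi with t ≟ x
      ...   | no t≢x = t , t<N , M′-intro t≢x Mt , lo , hi
      -- An index pierced at `x` is pierced at `y` if it is below `up s y`. Otherwise it is at least
      -- `dn s z` and is pierced at `z`; for `z = N` this would give an index not below `n`.
      ...   | yes refl with i <? up s y
      ...     | yes i<y = case My of λ
                { (inj₁ refl) → ⊥-elim (n≮0 i<y)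
                ; (inj₂ e) → y , <-trans y<x t<N , M′-intro (<⇒≢ y<x) e ,
                             ≤-trans (cnt-mono (not ∘ s) (<⇒≤ y<x)) lo , i<y }
      ...     | no i≮y = case m≤n⇒m<n∨m≡n z≤N of λ
                { (inj₂ refl) → ⊥-elim (<⇒≱ i<n (subst (_≤ i) dn-end z≤i))
                ; (inj₁ z<N) → case Mz of λ
                  { (inj₁ refl) → ⊥-elim (<-irrefl refl z<N)
                  ; (inj₂ e) → z , z<N , M′-intro (λ z≡x → <⇒≢ x<z (sym z≡x)) e , z≤i ,
                               <-≤-trans hi (cnt-mono s (<⇒≤ x<z)) } }
        where
        z≤i = ≤-trans le (≮⇒≥ i≮y)

    -- Otherwise index `up s y` would open after `y` and close before `z`, so its mark would lie
    -- inside the segment.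
    cover : Seg y z → dn s z ≤ up s y
    cover {y} {z} S = ≮⇒≥ λ lt → case marks-pierce (<-≤-trans lt (dn≤n (Seg.z≤N S))) of λ
      { (x , _ , Mx , lo , hi) → true≢false Mx (Seg.none S {x} (cnt-reflects-< s hi)
                                   (cnt-reflects-< (not ∘ s) (≤-<-trans lo lt))) }

    up-decreasing : Seg y z → up s y ≤ i → i < j → j < up s z → f j < f i
    up-decreasing {y} {z} S y≤i i<j j<z with cnt-find s z j<z | cnt-find s z (<-trans i<j j<z)
    ... | q , q<z , sq , uq | p , p<z , sp , upp = subst₂ _<_ (cong f (trans (ix-U D sq) uq)) (cong f (trans (ix-U D sp) upp))
        (decreasing (Seg.none S) (≤-pred (cnt-reflects-< s (≤-<-trans y≤i (subst₂ _<_ upp (sym (up-U sp)) ≤-refl))))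
          (cnt-reflects-< s (subst₂ _<_ (sym upp) (sym uq) i<j)) q<z)

    dn-decreasing : Seg y z → dn s y ≤ i → i < j → j < dn s z → f j < f i
    dn-decreasing {y} {z} S y≤i i<j j<z with cnt-find (not ∘ s) z j<z | cnt-find (not ∘ s) z (<-trans i<j j<z)
    ... | q , q<z , sq , dq | p , p<z , sp , dp =
      subst₂ _<_ (cong f (trans (ix-D D (not-true⁻¹ sq)) dq)) (cong f (trans (ix-D D (not-true⁻¹ sp)) dp))
        (decreasing (Seg.none S) (≤-pred (cnt-reflects-< (not ∘ s)
            (≤-<-trans y≤i (subst₂ _<_ dp (sym (cnt-true {not ∘ s} sp)) ≤-refl))))
          (cnt-reflects-< (not ∘ s) (subst₂ _<_ (sym dp) (sym dq) i<j)) q<z)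

    weaken : (i < j → f j < f i) → i ≤ j → f j ≤ f i
    weaken h i≤j with m≤n⇒m<n∨m≡n i≤j
    ... | inj₁ l    = <⇒≤ (h l)
    ... | inj₂ refl = ≤-refl

    before : Seg y z → 0 < y → ∃ λ x → Seg x y
    before {suc y} S 0<y = case Seg.y-mk S of λ
      { (inj₂ e) → _ , seg-before (<-≤-trans (Seg.y<z S) (Seg.z≤N S)) e }

    after : Seg y z → z < N → ∃ λ t → Seg z t
    after S z<N = case Seg.z-mk S of λ
      { (inj₁ refl) → ⊥-elim (<-irrefl refl z<N) ; (inj₂ e) → _ , seg-after z<N e }

    irredundant-segs : Seg x y → Seg y z → up s x < dn s z
    irredundant-segs S T = case Seg.y-mk T of λ
      { (inj₁ refl) → ⊥-elim (n≮0 (Seg.y<z S))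
      ; (inj₂ e) → irredundant (Seg.y<z S) (Seg.y<z T) (Seg.z≤N T) e (Seg.y-mk S) (Seg.z-mk T) }

    -- With v = dn z < up y = u, a step U before a step D inside the segment would close the cycle
    -- f(up p) > f(dn q) ≥ f(v-1) > f(v) > f(u) ≥ f(up p): the second inequality comes from the
    -- down-steps of this segment, the next two from the neighbouring segments.
    no-UD : Seg y z → dn s z < up s y → y ≤ p → p < q → q < z → s p ≡ true → s q ≡ false → ⊥
    no-UD {y} {z} {p} {q} S v<u y≤p p<q q<z sp sq with before S 0<y | after S z<N
      where
      0<y : 0 < y
      0<y = cnt-reflects-< {0} s (≤-<-trans z≤n v<u)
      z<N : z < N
      z<N = cnt-reflects-< (not ∘ s) (<-≤-trans v<u
        (subst (up s y ≤_) (sym dn-end) (up≤n (≤-trans (<⇒≤ (Seg.y<z S)) (Seg.z≤N S)))))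
    ... | x , S⁻ | t , S⁺ with dn s z in v≡ | irredundant-segs S⁻ S
    ...   | suc v | s≤s x≤v = <-irrefl refl (begin-strict
        f (up s p)  ≤⟨ weaken (λ l → up-decreasing S ≤-refl l (cnt-mono-true {s} sp (<-trans p<q q<z))) (cnt-mono s y≤p) ⟩
        f (up s y)  <⟨ dn-decreasing S⁺ (≤-reflexive v≡) v<u (irredundant-segs S S⁺) ⟩
        f (suc v)   <⟨ up-decreasing S⁻ x≤v ≤-refl v<u ⟩
        f v         ≤⟨ weaken (λ l → dn-decreasing S (cnt-mono (not ∘ s) (≤-trans y≤p (<⇒≤ p<q))) l (subst (v <_) (sym v≡) ≤-refl))
                         (≤-pred (subst (dn s q <_) v≡ (cnt-mono-true {not ∘ s} (not-true sq) q<z))) ⟩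
        f (dn s q)  ≡⟨ cong f (ix-D D sq) ⟨
        f (ix s q)  <⟨ decreasing (Seg.none S) y≤p p<q q<z ⟩
        f (ix s p)  ≡⟨ cong f (ix-U D sp) ⟩
        f (up s p)  ∎)
      where open ≤-Reasoning

    marks-admissible : Admissible
    marks-admissible = record
      { covers = cover
      -- Through the next segment: `up s y < dn s t ≤ up s z`. The line below uses the preceding
      -- segment in the same way.
      ; up-str = λ S z<N → let t , S⁺ = after S z<N in <-≤-trans (irredundant-segs S S⁺) (cover S⁺)
      ; dn-str = λ S 0<y → let x , S⁻ = before S 0<y in ≤-<-trans (cover S⁻) (irredundant-segs S⁻ S)
      ; shape  = no-UD }

-- Inserting labels into a linear order

-- The increasing bijection from the natural numbers onto those different from `c`.
bump : ℕ → ℕ → ℕ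
bump c x = if x <ᵇ c then x else suc x

bump-< : x < c → bump c x ≡ x
bump-< h rewrite <⇒<ᵇ≡true h = refl

bump-≥ : c ≤ x → bump c x ≡ suc x
bump-≥ h rewrite ≥⇒<ᵇ≡false h = refl

bump-mono-< : ∀ c → x < y → bump c x < bump c y
bump-mono-< {x} {y} c x<y with x <? c | y <? c
... | yes h | yes g = subst₂ _<_ (sym (bump-< h)) (sym (bump-< g)) x<y
... | yes h | no  g = subst₂ _<_ (sym (bump-< h)) (sym (bump-≥ (≮⇒≥ g))) (m<n⇒m<1+n x<y)
... | no  h | yes g = ⊥-elim (h (<-trans x<y g))
... | no  h | no  g = subst₂ _<_ (sym (bump-≥ (≮⇒≥ h))) (sym (bump-≥ (≮⇒≥ g))) (s≤s x<y)

bump-mono-≤ : ∀ c → x ≤ y → bump c x ≤ bump c y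
bump-mono-≤ c x≤y with m≤n⇒m<n∨m≡n x≤y
... | inj₁ x<y  = <⇒≤ (bump-mono-< c x<y)
... | inj₂ refl = ≤-refl

bump-injective : ∀ c → bump c x ≡ bump c y → x ≡ y
bump-injective c e = ≤-antisym (≮⇒≥ (λ h → <-irrefl (sym e) (bump-mono-< c h))) (≮⇒≥ (λ h → <-irrefl e (bump-mono-< c h)))

bump-≢ : ∀ c x → bump c x ≢ c
bump-≢ c x e with x <? c
... | yes h = <-irrefl (trans (sym (bump-< h)) e) h
... | no  h = <-irrefl (trans (sym e) (bump-≥ (≮⇒≥ h))) (s≤s (≮⇒≥ h))

bump-≤-suc : ∀ c x → bump c x ≤ suc x
bump-≤-suc c x with x <ᵇ c
... | true  = n≤1+n x
... | false = ≤-refl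

-- Comparisons made once survive all later insertions.
bump-<ᵇ : ∀ c x y → (bump c x <ᵇ bump c y) ≡ (x <ᵇ y)
bump-<ᵇ c x y with x <? y
... | yes h = trans (<⇒<ᵇ≡true (bump-mono-< c h)) (sym (<⇒<ᵇ≡true h))
... | no  h = trans (≥⇒<ᵇ≡false (bump-mono-≤ c (≮⇒≥ h))) (sym (≥⇒<ᵇ≡false (≮⇒≥ h)))

-- Here `f i` is the rank of index `i` among the `u` indices present. The new index `u` receives
-- rank `c`, and the ranks from `c` on move up by one.
insertAt : ℕ → ℕ → (ℕ → ℕ) → ℕ → ℕ
insertAt c u f i = if i ≡ᵇ u then c else bump c (f i)

insertAt-new : ∀ c u f → insertAt c u f u ≡ c
insertAt-new c u f rewrite ≡⇒≡ᵇ≡true {u} refl = refl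

insertAt-old : ∀ c u f → i < u → insertAt c u f i ≡ bump c (f i)
insertAt-old {i} c u f i<u with i ≡ᵇ u in e
... | true  = ⊥-elim (<⇒≢ i<u (≡ᵇ≡true⇒≡ e))
... | false = refl

Decreasing : (ℕ → ℕ) → ℕ → ℕ → Set
Decreasing f l u = ∀ {i j} → l ≤ i → i < j → j < u → f j < f i

module _ {u c : ℕ} (f : ℕ → ℕ) where
  private g = insertAt c u f

  insertAt-decreasing : m ≤ u → Decreasing f l m → Decreasing g l m
  insertAt-decreasing m≤u dec {i} {j} l≤i i<j j<m =
    subst₂ _<_ (sym (insertAt-old c u f j<u)) (sym (insertAt-old c u f (<-trans i<j j<u))) (bump-mono-< c (dec l≤i i<j j<m))
    where
    j<u = <-≤-trans j<m m≤u

  insertAt-below : i < u → c ≤ f i → g u < g i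
  insertAt-below i<u c≤ = subst₂ _<_ (sym (insertAt-new c u f)) (sym (trans (insertAt-old c u f i<u) (bump-≥ c≤))) (s≤s c≤)

  insertAt-above : i < u → f i < c → g i < g u
  insertAt-above i<u <c = subst₂ _<_ (sym (trans (insertAt-old c u f i<u) (bump-< <c))) (sym (insertAt-new c u f)) <c

  insertAt-low : (∀ {i} → l ≤ i → i < u → c ≤ f i) → ∀ {i} → l ≤ i → i < suc u → g u ≤ g i
  insertAt-low low l≤i i< with m≤n⇒m<n∨m≡n (≤-pred i<)
  ... | inj₁ i<u  = <⇒≤ (insertAt-below i<u (low l≤i i<u))
  ... | inj₂ refl = ≤-refl

  insertAt-extends : Decreasing f l u → (∀ {i} → l ≤ i → i < u → c ≤ f i) → Decreasing g l (suc u)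
  insertAt-extends dec low l≤i i<j j< with m≤n⇒m<n∨m≡n (≤-pred j<)
  ... | inj₁ j<u  = insertAt-decreasing ≤-refl dec l≤i i<j j<u
  ... | inj₂ refl = insertAt-below i<j (low l≤i i<j)

-- Realizing an inscribed path by a permutation

+-cross-< : ∀ {a b c d} → a + b ≡ c + d → a < c → d < b
+-cross-< {a} {b} {c} {d} e a<c = ≰⇒> λ b≤d → <⇒≢ (+-mono-<-≤ a<c b≤d) e

module Realize {n : ℕ} {d b : ℕ → Bool} (D : IsDyck n d) (B : IsDyck n b) (I : Inscribed n d b) where
  open Dyck D
  module B = Dyck B
  open Inscribed I

  -- Every letter read before vertex `k` has been inserted: a down-step repeats the index of an
  -- earlier up-step.
  ix<up : j < k → k ≤ N → ix d j < up d k
  ix<up {j} {k} j<k k≤N with d j in e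
  ... | true  = cnt-mono-true {d} e j<k
  ... | false = <-≤-trans (dn<up-at-D (<-≤-trans j<k k≤N) e) (cnt-mono d (<⇒≤ j<k))

  -- A ranking of the indices opened by the first `k` steps of `d`, correct at the vertices between
  -- two of these steps.
  record Partial (f : ℕ → ℕ) (k : ℕ) : Set where
    field
      bounded   : i < up d k → f i < up d k
      injective : i < up d k → j < up d k → f i ≡ f j → i ≡ j
      agrees    : suc j < k → ascents f d j ≡ peak b j

  -- The situation after a step of d with label p and a step β of b: u, v and ub, vb count the up-
  -- and down-steps of d and b so far. When the paths are apart, b is on its way to or from the
  -- axis, which it meets after kk up-steps.
  data Mode (f : ℕ → ℕ) (p u v : ℕ) (β : Bool) (ub vb : ℕ) : Set where
    meet-up : ∀ k₀ → ub ≡ u → β ≡ true → k₀ ≤ v → Decreasing f k₀ u →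
              (∀ {i} → k₀ ≤ i → i < u → f p ≤ f i) → Mode f p u v β ub vb
    meet-dn : ∀ k₀ → ub ≡ u → β ≡ false → k₀ ≤ p → suc p ≡ v → Decreasing f k₀ u → Mode f p u v β ub vb
    apart   : ∀ k₀ kk → ub < u → k₀ ≤ v → kk ≤ u → Decreasing f k₀ kk → Decreasing f kk u → f v < f p →
              (∀ {i} → kk ≤ i → i < u → f p ≤ f i) → vb ≤ kk →
              (β ≡ false × kk ≡ ub) ⊎ (β ≡ true × kk ≡ vb) → Mode f p u v β ub vb

  ModeAt : (ℕ → ℕ) → ℕ → Set
  ModeAt f k = Mode f (ix d k) (up d (suc k)) (dn d (suc k)) (b k) (up b (suc k)) (dn b (suc k))

  module Step {k : ℕ} {f : ℕ → ℕ} (K<N : suc k < N) (C : Partial f (suc k)) where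
    open Partial C
    private
      K = suc k
      last = ix d k
      u = up d K
      v = dn d K
      ub = up b K
      vb = dn b K
      K≤N = <⇒≤ K<N

    last<u : last < u
    last<u = ix<up ≤-refl K≤N

    extend : (g : ℕ → ℕ) → (∀ {i} → i < up d (suc K) → g i < up d (suc K)) →
      (∀ {i j} → i < up d (suc K) → j < up d (suc K) → g i ≡ g j → i ≡ j) →
      (∀ {j} → suc j < K → ascents g d j ≡ ascents f d j) → ascents g d k ≡ peak b k → Partial g (suc K)
    extend g bnd inj old new = record { bounded = bnd ; injective = inj ; agrees = λ h → case m≤n⇒m<n∨m≡n (≤-pred h) of λ
      { (inj₁ h′) → trans (old h′) (agrees h′) ; (inj₂ refl) → new } }

    extend-D : d K ≡ false → (peak b k ≡ true × f last ≤ f v) ⊎ (peak b k ≡ false × f v < f last) → Partial f (suc K)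
    extend-D e cmp = extend f
        (λ {i} h → subst (f i <_) (sym (up-D e)) (bounded (subst (i <_) (up-D e) h)))
        (λ {i} {j} h h′ → injective (subst (i <_) (up-D e) h) (subst (j <_) (up-D e) h′))
        (λ _ → refl)
        (trans (cong (λ t → not (f t <ᵇ f last)) (ix-D D e)) (new cmp))
      where
      new : (peak b k ≡ true × f last ≤ f v) ⊎ (peak b k ≡ false × f v < f last) → not (f v <ᵇ f last) ≡ peak b k
      new (inj₁ (t , h)) = trans (not-true (≥⇒<ᵇ≡false h)) (sym t)
      new (inj₂ (t , h)) = trans (not-false (<⇒<ᵇ≡true h)) (sym t)

    extend-U : d K ≡ true → c ≤ u → (peak b k ≡ true × f last < c) ⊎ (peak b k ≡ false × c ≤ f last) →
               Partial (insertAt c u f) (suc K)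
    extend-U {c} e c≤u cmp = extend g
        (λ {i} h → subst (g i <_) (sym (up-U e)) (bnd (subst (i <_) (up-U e) h)))
        (λ {i} {j} h h′ → inj (subst (i <_) (up-U e) h) (subst (j <_) (up-U e) h′))
        (λ {j} h → cong not (trans (cong₂ _<ᵇ_ (insertAt-old c u f (ix<up h K≤N))
                                               (insertAt-old c u f (ix<up (<-trans (n<1+n j) h) K≤N)))
                                   (bump-<ᵇ c _ _)))
        (trans (cong (λ t → not (g t <ᵇ g last)) (ix-U D e)) (new cmp))
      where
      g = insertAt c u f
      bnd : ∀ {i} → i < suc u → g i < suc u
      bnd h with m≤n⇒m<n∨m≡n (≤-pred h)
      ... | inj₁ i<u  = s≤s (subst (_≤ u) (sym (insertAt-old c u f i<u)) (≤-trans (bump-≤-suc c _) (bounded i<u)))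
      ... | inj₂ refl = s≤s (subst (_≤ u) (sym (insertAt-new c u f)) c≤u)
      inj : ∀ {i j} → i < suc u → j < suc u → g i ≡ g j → i ≡ j
      inj {i} {j} h h′ e with m≤n⇒m<n∨m≡n (≤-pred h) | m≤n⇒m<n∨m≡n (≤-pred h′)
      ... | inj₁ l | inj₁ l′ = injective l l′ (bump-injective c
          (trans (sym (insertAt-old c u f l)) (trans e (insertAt-old c u f l′))))
      ... | inj₁ l | inj₂ refl = ⊥-elim (bump-≢ c (f i)
          (trans (sym (insertAt-old c u f l)) (trans e (insertAt-new c u f))))
      ... | inj₂ refl | inj₁ l′ = ⊥-elim (bump-≢ c (f j)
          (trans (sym (insertAt-old c u f l′)) (trans (sym e) (insertAt-new c u f))))
      ... | inj₂ refl | inj₂ refl = refl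
      new : (peak b k ≡ true × f last < c) ⊎ (peak b k ≡ false × c ≤ f last) → not (g u <ᵇ g last) ≡ peak b k
      new (inj₁ (t , h)) = trans (not-true (≥⇒<ᵇ≡false (<⇒≤ (insertAt-above f last<u h)))) (sym t)
      new (inj₂ (t , h)) = trans (not-false (<⇒<ᵇ≡true (insertAt-below f last<u h))) (sym t)

    peak-yes : b k ≡ true → b K ≡ false → peak b k ≡ true
    peak-yes e e′ = cong₂ _∧_ e (not-true e′)

    no-peak-D : b k ≡ false → peak b k ≡ false
    no-peak-D e = cong (_∧ not (b K)) e

    no-peak-U : b K ≡ true → peak b k ≡ false
    no-peak-U e = trans (cong (λ t → b k ∧ not t) e) (∧-zeroʳ (b k))

    balance : ub + vb ≡ u + v
    balance = trans (cnt-not b K) (sym (cnt-not d K))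

    crossing : ub ≡ u → b K ≡ true → d K ≡ false → ⊥
    crossing e eb ed = <⇒≱ (subst₂ _<_ e (sym (B.up-U eb)) ≤-refl)
                           (subst (up b (suc K) ≤_) (up-D ed) (under K<N))

    v<u : ub ≡ u → b K ≡ false → v < u
    v<u e eb = subst₂ _<_ (+-cancelˡ-≡ ub _ _ (trans balance (cong (_+ v) (sym e)))) e (B.dn<up-at-D K<N eb)

    dn-b≤u : ub ≡ u → b K ≡ false → suc vb ≤ u
    dn-b≤u e eb = subst (suc vb ≤_) e (B.dn<up-at-D K<N eb)

    Next : Set
    Next = ∃ λ g → Partial g (suc K) × ModeAt g K

    mode : ∀ {g β δ} → b K ≡ β → d K ≡ δ →
      Mode g (if δ then u else v) (if δ then suc u else u) (if δ then v else suc v)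
           β (if β then suc ub else ub) (if β then vb else suc vb) →
      ModeAt g K
    mode {β = true}  {true}  eb ed m rewrite eb | ed = m
    mode {β = true}  {false} eb ed m rewrite eb | ed = m
    mode {β = false} {true}  eb ed m rewrite eb | ed = m
    mode {β = false} {false} eb ed m rewrite eb | ed = m

    bottom : ∀ k₀ → ub ≡ u → k₀ ≤ v → Decreasing f k₀ u → b K ≡ true → d K ≡ true → Next
    bottom k₀ e k₀≤v dec eb ed = insertAt 0 u f , extend-U ed z≤n (inj₂ (no-peak-U eb , z≤n)) ,
      mode eb ed (meet-up k₀ (cong suc e) refl k₀≤v (insertAt-extends f dec (λ _ _ → z≤n)) (insertAt-low f (λ _ _ → z≤n)))

    depart : ∀ k₀ c → ub ≡ u → k₀ ≤ v → Decreasing f k₀ u → f v < c → b K ≡ false → d K ≡ true →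
             Mode (insertAt c u f) u (suc u) v false ub (suc vb)
    depart k₀ c e k₀≤v dec v<c eb ed =
      -- Taking `kk` to be `u` makes the new index the only one at or above `kk`.
      apart k₀ u (s≤s (≤-reflexive e)) k₀≤v (n≤1+n u) (insertAt-decreasing f ≤-refl dec)
        (λ l≤i i<j j< → ⊥-elim (<⇒≱ (≤-<-trans l≤i i<j) (≤-pred j<)))
        (insertAt-above f (v<u e eb) v<c)
        (insertAt-low f (λ l i<u → ⊥-elim (<⇒≱ i<u l)))
        (dn-b≤u e eb) (inj₁ (refl , sym e))

    -- Where the paths meet, ranks decrease on the indices from `k₀` to `u`, so successive
    -- down-steps read descents. In `apart`, the indices below `kk` were opened before the paths
    -- separated, and they are the ones that `d` closes until the paths rejoin, because
    -- `v < vb ≤ kk`. The later ones decrease as well and stay above `f v`, the next letter to be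
    -- closed.
    step : ModeAt f k → Next
    step (meet-up k₀ e β k₀≤v dec low) = go (b K) (d K) refl refl
      where
      go : ∀ x y → b K ≡ x → d K ≡ y → Next
      go true true eb ed = bottom k₀ e k₀≤v dec eb ed
      go true false eb ed = ⊥-elim (crossing e eb ed)
      go false false eb ed = f , extend-D ed (inj₁ (peak-yes β eb , low k₀≤v (v<u e eb))) ,
        mode eb ed (meet-dn k₀ e refl k₀≤v refl dec)
      go false true eb ed = insertAt u u f , extend-U ed ≤-refl (inj₁ (peak-yes β eb , bounded last<u)) ,
        mode eb ed (depart k₀ u e k₀≤v dec (bounded (v<u e eb)) eb ed)
    step (meet-dn k₀ e β k₀≤p p+1 dec) = go (b K) (d K) refl refl
      where
      p<v : last < v
      p<v = ≤-reflexive p+1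
      k₀≤v = ≤-trans k₀≤p (<⇒≤ p<v)
      go : ∀ x y → b K ≡ x → d K ≡ y → Next
      go true true eb ed = bottom k₀ e k₀≤v dec eb ed
      go true false eb ed = ⊥-elim (crossing e eb ed)
      go false false eb ed = f , extend-D ed (inj₂ (no-peak-D β , dec k₀≤p p<v (v<u e eb))) ,
        mode eb ed (meet-dn k₀ e refl k₀≤v refl dec)
      go false true eb ed = insertAt (f last) u f , extend-U ed (<⇒≤ (bounded last<u)) (inj₂ (no-peak-D β , ≤-refl)) ,
        mode eb ed (depart k₀ (f last) e k₀≤v dec (dec k₀≤p p<v (v<u e eb)) eb ed)
    step (apart k₀ kk ub<u k₀≤v kk≤u dec₀ dec₁ v<p low vb≤kk rel) = go (b K) (d K) refl refl
      where
      -- Turning down here would create a peak of `b` off `d`, so `b` was falling already.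
      kk-D : b K ≡ false → b k ≡ false × kk ≡ ub
      kk-D eb = case rel of λ
        { (inj₁ r) → r ; (inj₂ (β , _)) → ⊥-elim (<⇒≢ ub<u (peaks K<N β eb)) }
      -- Turning up here is a valley of `b` off `d`, hence on the axis, where `kk ≡ ub` becomes
      -- `kk ≡ vb`.
      kk-U : b K ≡ true → kk ≡ vb
      kk-U eb = case rel of λ
        { (inj₂ (_ , r)) → r
        ; (inj₁ (β , r)) → case valleys K<N β eb of λ
          { (inj₁ (_ , t)) → ⊥-elim (<⇒≢ ub<u t) ; (inj₂ t) → trans r t } }
      np : ∀ x → b K ≡ x → peak b k ≡ false
      np true  eb = no-peak-U eb
      np false eb = no-peak-D (proj₁ (kk-D eb))
      vb<kk : b K ≡ false → vb < kk
      vb<kk eb = subst (vb <_) (sym (proj₂ (kk-D eb))) (B.dn<up-at-D K<N eb)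
      v<vb : v < vb
      v<vb = +-cross-< balance ub<u
      inserted : ∀ {β ub′ vb′} → ub′ < suc u → vb′ ≤ kk → (β ≡ false × kk ≡ ub′) ⊎ (β ≡ true × kk ≡ vb′) →
                 Mode (insertAt (f last) u f) u (suc u) v β ub′ vb′
      inserted h h′ r = apart k₀ kk h k₀≤v (m≤n⇒m≤1+n kk≤u) (insertAt-decreasing f kk≤u dec₀)
        (insertAt-extends f dec₁ low) (insertAt-above f (<-≤-trans v<vb (≤-trans vb≤kk kk≤u)) v<p) (insertAt-low f low) h′ r
      dropped : ∀ {β ub′ vb′} → ub′ < u → suc v < kk → vb′ ≤ kk → (β ≡ false × kk ≡ ub′) ⊎ (β ≡ true × kk ≡ vb′) →
                Mode f v u (suc v) β ub′ vb′
      dropped h l h′ r = apart k₀ kk h (m≤n⇒m≤1+n k₀≤v) kk≤u dec₀ dec₁ (dec₀ k₀≤v ≤-refl l)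
        (λ l i<u → <⇒≤ (<-≤-trans v<p (low l i<u))) h′ r
      go : ∀ x y → b K ≡ x → d K ≡ y → Next
      go true true eb ed = insertAt (f last) u f , extend-U ed (<⇒≤ (bounded last<u)) (inj₂ (np _ eb , ≤-refl)) ,
        mode eb ed (inserted (s≤s ub<u) vb≤kk (inj₂ (refl , kk-U eb)))
      go false true eb ed = insertAt (f last) u f , extend-U ed (<⇒≤ (bounded last<u)) (inj₂ (np _ eb , ≤-refl)) ,
        mode eb ed (inserted (m<n⇒m<1+n ub<u) (vb<kk eb) (inj₁ (refl , proj₂ (kk-D eb))))
      go false false eb ed = f , extend-D ed (inj₂ (np _ eb , v<p)) ,
        mode eb ed (dropped ub<u (≤-<-trans v<vb (vb<kk eb)) (vb<kk eb) (inj₁ (refl , proj₂ (kk-D eb))))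
      go true false eb ed = f , extend-D ed (inj₂ (np _ eb , v<p)) , mode eb ed (landing (m≤n⇒m<n∨m≡n ub<u))
        where
        balance′ : suc ub + vb ≡ u + suc v
        balance′ = trans (cong suc balance) (sym (+-suc u v))
        landing : suc ub < u ⊎ suc ub ≡ u → Mode f v u (suc v) true (suc ub) vb
        landing (inj₁ l) = dropped l (<-≤-trans (+-cross-< balance′ l) vb≤kk) vb≤kk (inj₂ (refl , kk-U eb))
        -- All indices below `kk` are closed now, as `kk ≡ vb ≡ suc v`, so `kk` becomes the new
        -- `k₀`.
        landing (inj₂ q) = meet-up kk q refl
          (≤-reflexive (trans (kk-U eb) (+-cancelˡ-≡ u _ _ (trans (cong (_+ vb) (sym q)) balance′)))) dec₁
          (λ l i<u → <⇒≤ (<-≤-trans v<p (low l i<u)))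

  first-U : ∀ {s} → IsDyck n s → 0 < N → s 0 ≡ true
  first-U {s} S 0<N with s 0 in e
  ... | true  = refl
  ... | false = ⊥-elim (n≮0 (Dyck.dn<up-at-D S 0<N e))

  start : 0 < N → Partial (λ _ → 0) 1 × ModeAt (λ _ → 0) 0
  start 0<N = record { bounded   = λ _ → subst (0 <_) (sym up≡1) (s≤s z≤n)
                     ; injective = λ h h′ _ → trans (only h) (sym (only h′))
                     ; agrees    = λ { (s≤s ()) } } , mode₀
    where
    up≡1 : up d 1 ≡ 1
    up≡1 = up-U (first-U D 0<N)
    only : i < up d 1 → i ≡ 0
    only {i} h = n≤0⇒n≡0 (≤-pred (subst (i <_) up≡1 h))
    mode₀ : ModeAt (λ _ → 0) 0
    mode₀ rewrite first-U D 0<N | first-U B 0<N =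
      meet-up 0 refl refl z≤n (λ { _ i<j (s≤s z≤n) → ⊥-elim (n≮0 i<j) }) (λ _ _ → z≤n)

  run : ∀ k → k < N → ∃ λ f → Partial f (suc k) × ModeAt f k
  run zero    h = _ , start h
  run (suc k) h = let f , C , m = run k (<⇒≤ h) in Step.step h C m

  realize : ∃ λ f → (∀ {i} → i < n → f i < n) × (∀ {i j} → i < n → j < n → f i ≡ f j → i ≡ j) ×
            (∀ {j} → suc j < N → ascents f d j ≡ peak b j)
  realize = go N refl
    where
    go : ∀ m → m ≡ N → ∃ λ f → (∀ {i} → i < n → f i < n) × (∀ {i j} → i < n → j < n → f i ≡ f j → i ≡ j) ×
         (∀ {j} → suc j < N → ascents f d j ≡ peak b j)
    go zero e = (λ i → i) , id , (λ _ _ → id) , λ {j} h → ⊥-elim (n≮0 (subst (suc j <_) (sym e) h))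
    go (suc k) e with run k (≤-reflexive e)
    ... | f , C , _ = f ,
      (λ {i} → subst (λ t → i < t → f i < t) eq bounded) ,
      (λ {i} {j} → subst (λ t → i < t → j < t → f i ≡ f j → i ≡ j) eq injective) ,
      (λ {j} h → agrees (subst (suc j <_) (sym e) h))
      where
      open Partial C
      eq : up d (suc k) ≡ n
      eq = trans (cong (up d) e) up-end

-- From heights to up-counts

module _ {n : ℕ} (d : DyckPath n) where
  private
    w = path d
    s = at w

  stepAt-path : k < 2 * n → ∀ {c} → s k ≡ c → stepAt w k ≡ just c
  stepAt-path h e = trans (stepAt-at w (subst (_ <_) (sym (len d)) h)) (cong just e)

  stepAt-path⁻¹ : ∀ {c} → stepAt w k ≡ just c → k < 2 * n × s k ≡ c
  stepAt-path⁻¹ e = let h , e′ = stepAt-just w e in subst (_ <_) (len d) h , e′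

  -- At a fixed abscissa this makes the height an increasing function of the up-count, with no
  -- subtraction involved.
  height-2up : k ≤ 2 * n → height w k + k ≡ 2 * up s k
  height-2up {k} h = begin
    height w k + k                  ≡⟨ cong (height w k +_) (trans (sym (cnt-not s k)) (+-comm (up s k) _)) ⟩
    height w k + (dn s k + up s k)  ≡⟨ +-assoc (height w k) _ _ ⟨
    height w k + dn s k + up s k    ≡⟨ cong (_+ up s k) (height-up-dn d h) ⟩
    up s k + up s k                 ≡⟨ 2*-+ (up s k) ⟨
    2 * up s k                      ∎
    where open ≡-Reasoning

  height-0⇒ : k ≤ 2 * n → height w k ≡ 0 → up s k ≡ dn s k
  height-0⇒ {k} h e = sym (trans (cong (_+ dn s k) (sym e)) (height-up-dn d h))

  height-0⇐ : k ≤ 2 * n → up s k ≡ dn s k → height w k ≡ 0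
  height-0⇐ {k} h e = +-cancelʳ-≡ (dn s k) _ _ (trans (height-up-dn d h) e)

  height-beyond : 2 * n ≤ k → height w k ≡ 0
  height-beyond {k} h = trans (heightFrom-beyond 0 w k (subst (_≤ k) (sym (len d)) h)) (heightFrom-end 0 w (valid d))

module _ {n : ℕ} (d b : DyckPath n) where
  private
    s = at (path d)
    t = at (path b)

  up-≤⇒height-≤ : k ≤ 2 * n → up t k ≤ up s k → height (path b) k ≤ height (path d) k
  up-≤⇒height-≤ {k} h l = +-cancelʳ-≤ k _ _
    (subst₂ _≤_ (sym (height-2up b h)) (sym (height-2up d h)) (*-monoʳ-≤ 2 l))

  height-≤⇒up-≤ : k ≤ 2 * n → height (path b) k ≤ height (path d) k → up t k ≤ up s k
  height-≤⇒up-≤ {k} h l = *-cancelˡ-≤ 2 (subst₂ _≤_ (height-2up b h) (height-2up d h) (+-monoˡ-≤ k l))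

module _ {n : ℕ} (d b : DyckPath n) where
  private
    s = at (path d)
    t = at (path b)

  -- The inequalities come from a separate module so that they can be applied with `d` and `b`
  -- exchanged.
  up-≡⇒height-≡ : k ≤ 2 * n → up t k ≡ up s k → height (path b) k ≡ height (path d) k
  up-≡⇒height-≡ h e = ≤-antisym (up-≤⇒height-≤ d b h (≤-reflexive e)) (up-≤⇒height-≤ b d h (≤-reflexive (sym e)))

  height-≡⇒up-≡ : k ≤ 2 * n → height (path b) k ≡ height (path d) k → up t k ≡ up s k
  height-≡⇒up-≡ h e = ≤-antisym (height-≤⇒up-≤ d b h (≤-reflexive e)) (height-≤⇒up-≤ b d h (≤-reflexive (sym e)))

  InB⇒Inscribed : InB d b → Inscribed n s t
  InB⇒Inscribed (under , _ , peaks , valleys) = record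
    { under   = λ {k} h → height-≤⇒up-≤ d b h (under k)
    ; peaks   = λ {k} h e e′ → height-≡⇒up-≡ (<⇒≤ h)
                  (peaks k (stepAt-path b (<-trans (n<1+n k) h) e , stepAt-path b h e′))
    ; valleys = λ {k} h e e′ →
        case valleys k (stepAt-path b (<-trans (n<1+n k) h) e , stepAt-path b h e′) of λ
        { (inj₁ ((v , v′) , q)) → inj₁ ((proj₂ (stepAt-path⁻¹ d v) , proj₂ (stepAt-path⁻¹ d v′)) ,
                                        height-≡⇒up-≡ (<⇒≤ h) (sym q))
        ; (inj₂ q) → inj₂ (height-0⇒ b (<⇒≤ h) q) } }

  Inscribed⇒InB : Inscribed n s t → pk (path b) ≡ bpk (path d) → InB d b
  Inscribed⇒InB I pk≡ = under′ , pk≡ , peaks′ , valleys′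
    where
    open Inscribed I
    under′ : ∀ k → height (path b) k ≤ height (path d) k
    under′ k with k ≤? 2 * n
    ... | yes h = up-≤⇒height-≤ d b h (under h)
    ... | no  h = subst (_≤ height (path d) k) (sym (height-beyond b (<⇒≤ (≰⇒> h)))) z≤n
    peaks′ : ∀ k → IsPeak (path b) k → height (path b) (suc k) ≡ height (path d) (suc k)
    peaks′ k (e , e′) = let h , q = stepAt-path⁻¹ b e′ in
      up-≡⇒height-≡ (<⇒≤ h) (peaks h (proj₂ (stepAt-path⁻¹ b e)) q)
    valleys′ : ∀ k → IsValley (path b) k →
      (IsValley (path d) k × height (path d) (suc k) ≡ height (path b) (suc k)) ⊎ height (path b) (suc k) ≡ 0
    valleys′ k (e , e′) with stepAt-path⁻¹ b e′
    ... | h , q with valleys h (proj₂ (stepAt-path⁻¹ b e)) q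
    ...   | inj₁ ((v , v′) , r) = inj₁ ((stepAt-path d (<-trans (n<1+n k) h) v , stepAt-path d h v′) ,
                                        sym (up-≡⇒height-≡ (<⇒≤ h) r))
    ...   | inj₂ r = inj₂ (height-0⇐ b (<⇒≤ h) r)

Inscribed-ext : ∀ {s t t′ : ℕ → Bool} → (∀ {k} → k < 2 * n → t k ≡ t′ k) → Inscribed n s t → Inscribed n s t′
Inscribed-ext {n} {s} {t} {t′} ext I = record
  { under   = λ {k} h → subst (_≤ up s k) (eu h) (under h)
  ; peaks   = λ {k} h e e′ → trans (sym (eu (<⇒≤ h))) (peaks h (trans (ext (<-trans (n<1+n k) h)) e) (trans (ext h) e′))
  ; valleys = λ {k} h e e′ → case valleys h (trans (ext (<-trans (n<1+n k) h)) e) (trans (ext h) e′) of λ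
      { (inj₁ (v , q)) → inj₁ (v , trans (sym (eu (<⇒≤ h))) q)
      ; (inj₂ q) → inj₂ (trans (sym (eu (<⇒≤ h))) (trans q (ed (<⇒≤ h)))) } }
  where
  open Inscribed I
  eu : ∀ {k} → k ≤ 2 * n → up t k ≡ up t′ k
  eu {k} h = cnt-ext {t} k (λ l → ext (<-≤-trans l h))
  ed : ∀ {k} → k ≤ 2 * n → dn t k ≡ dn t′ k
  ed {k} h = cnt-ext {not ∘ t} k (λ l → cong not (ext (<-≤-trans l h)))

-- Extremal permutations and the two inclusions

module _ {n : ℕ} (d : DyckPath n) where
  private
    N = 2 * n
    s = at (path d)
    D = at-dyck d

  asc : Permutation′ n → ℕ
  asc σ = cnt (ascents (lookupℕ (word σ)) s) (N ∸ 1)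

  des+asc : ∀ σ → des d σ + asc σ ≡ N ∸ 1
  des+asc σ = length-DesWord (word σ) d

  asc-marks : ∀ σ → asc σ ≡ cnt (marks (lookupℕ (word σ)) s) N
  asc-marks σ = shift N
    where
    f = lookupℕ (word σ)
    shift : ∀ m → cnt (ascents f s) (m ∸ 1) ≡ cnt (marks f s) m
    shift zero    = refl
    shift (suc m) = sym (cnt-front (marks f s) m)

  bpk≤asc : ∀ σ → bpk (path d) ≤ asc σ
  bpk≤asc σ = subst₂ _≤_ (sym (Bounce.bpk-greedy d)) (sym (asc-marks σ)) (Marks.greedy≤marks D (lookupℕ (word σ)))

  -- Since `des` and `asc` have a constant sum, attaining the lower bound `bpk` for `asc` means
  -- attaining the maximum of `des`.
  asc-min⇒InM : ∀ σ → asc σ ≤ bpk (path d) → InM d σ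
  asc-min⇒InM σ h τ = +-cancelʳ-≤ (asc τ) _ _ (begin
    des d τ + asc τ  ≡⟨ trans (des+asc τ) (sym (des+asc σ)) ⟩
    des d σ + asc σ  ≤⟨ +-monoʳ-≤ (des d σ) (≤-trans h (bpk≤asc τ)) ⟩
    des d σ + asc τ  ∎)
    where open ≤-Reasoning

  InM⇒asc-≤ : ∀ σ τ → InM d σ → asc σ ≤ asc τ
  InM⇒asc-≤ σ τ M = +-cancelˡ-≤ (des d τ) _ _ (begin
    des d τ + asc σ  ≤⟨ +-monoˡ-≤ (asc σ) (M τ) ⟩
    des d σ + asc σ  ≡⟨ trans (des+asc σ) (sym (des+asc τ)) ⟩
    des d τ + asc τ  ∎)
    where open ≤-Reasoning

  realizing-permutation : ∀ {t} → IsDyck n t → Inscribed n s t →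
    ∃ λ σ → ∀ {k} → suc k < N → ascents (lookupℕ (word σ)) s k ≡ peak t k
  realizing-permutation B I with Realize.realize D B I
  ... | f , bnd , inj , eq with bijection⇒word f bnd inj
  ...   | σ , val = σ , λ {k} h → trans
        (cong not (cong₂ _<ᵇ_ (val (ix<n D h)) (val (ix<n D (<-trans (n<1+n k) h))))) (eq h)

  Des≡DesDelta : ∀ σ b → (∀ {k} → suc k < N → ascents (lookupℕ (word σ)) s k ≡ peak (at (path b)) k) → Des d σ ≡ DesDelta b
  Des≡DesDelta σ b h = DesWord-ext (word σ) d (δ n) b (λ l → trans (h l) (sym (ascents-δ (at-dyck b) l)))

  asc≡pk : ∀ σ (b : DyckPath n) → (∀ {k} → suc k < N → ascents (lookupℕ (word σ)) s k ≡ peak (at (path b)) k) →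
           asc σ ≡ pk (path b)
  asc≡pk σ b h = trans (cnt-ext (N ∸ 1) (h ∘ <∸1⇒suc<))
    (sym (trans (pk-cnt (path b)) (cong (λ l → cnt (peak (at (path b))) (l ∸ 1)) (len b))))

  permutation-of-path : (b : DyckPath n) → InB d b → ∃ λ σ → InM d σ × Des d σ ≡ DesDelta b
  permutation-of-path b Bd@(_ , pk≡ , _) with realizing-permutation (at-dyck b) (InB⇒Inscribed d b Bd)
  ... | σ , h = σ , asc-min⇒InM σ (≤-reflexive (trans (asc≡pk σ b h) pk≡)) , Des≡DesDelta σ b h

  -- Shows that the lower bound is attained, hence attained by every member of `M`; this supplies
  -- the minimality that `Minimal` assumes.
  bounce-permutation : ∃ λ τ → asc τ ≤ bpk (path d)
  bounce-permutation = let τ , h = realizing-permutation (env-dyck G) (env-inscribed G) in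
    τ , subst₂ _≤_ (sym (cnt-ext (N ∸ 1) (λ {k} l → trans (h (<∸1⇒suc< l)) (peak-env G (<∸1⇒suc< l)))))
                   (sym (Bounce.bpk-greedy d)) (shift N)
    where
    open Envelope D (greedy s)
    G = greedy-admissible D
    -- Step `k` belongs to vertex `suc k`; leaving out vertex `0` can only lower the count.
    shift : ∀ m → cnt (greedy s ∘ suc) (m ∸ 1) ≤ cnt (greedy s) m
    shift zero = z≤n
    shift (suc m) rewrite cnt-front (greedy s) m with greedy s 0
    ... | true  = n≤1+n _
    ... | false = ≤-refl

  path-of-permutation : ∀ σ → InM d σ → ∃ λ (b : DyckPath n) → InB d b × Des d σ ≡ DesDelta b
  path-of-permutation σ Mσ = e , Inscribed⇒InB d e (Inscribed-ext at≡ (env-inscribed A))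
      (trans (sym (asc≡pk σ e peaks)) (≤-antisym asc≤bpk (bpk≤asc σ))) , Des≡DesDelta σ e peaks
    where
    f = lookupℕ (word σ)
    asc≤bpk : asc σ ≤ bpk (path d)
    asc≤bpk = let τ , h = bounce-permutation in ≤-trans (InM⇒asc-≤ σ τ Mσ) h
    open Marks D f
    open Minimal (subst₂ _≤_ (asc-marks σ) (Bounce.bpk-greedy d) asc≤bpk)
    open Envelope D (marks f s)
    A = marks-admissible
    e : DyckPath n
    e = toPath (env A) (env-dyck A)
    at≡ : ∀ {k} → k < N → env A k ≡ at (path e) k
    at≡ h = sym (at-applyUpTo (env A) N h)
    peaks : ∀ {k} → suc k < N → ascents f s k ≡ peak (at (path e)) k
    peaks {k} h = trans (sym (peak-env A h)) (cong₂ (λ x y → x ∧ not y) (at≡ (<-trans (n<1+n k) h)) (at≡ h))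

theorem6p3 : (n : ℕ) (d : DyckPath n) →
    ((σ : Permutation′ n) → InM d σ → ∃ (λ (b : DyckPath n) → InB d b × Des d σ ≡ DesDelta b))
    × ((b : DyckPath n) → InB d b → ∃ (λ (σ : Permutation′ n) → InM d σ × Des d σ ≡ DesDelta b))
theorem6p3 n d = path-of-permutation d , permutation-of-path d
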